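{- Let $n\geq 1$ and let $p,q,t,x$ be indeterminates. Define $$A_n(p,q,t)=\sum_{\sigma\in\mathfrak{S}_n}p^{\mathsf{nest}\,\sigma}q^{\mathsf{cros}\,\sigma}t^{\mathsf{exc}\,\sigma}.$$ Then $$A_{n}(p, q, t)=\left(\frac{1+xt}{1+x}\right)^{n-1}P^{(\mathsf{nest}, \mathsf{cros},\mathsf{cpk}^*,\mathsf{exc})}\left(\mathfrak{S}_n; p, q, \frac{(1+x)^{2}t}{(x+t)(1+xt)},\frac{x+t}{1+xt}\right),$$ equivalently, $$P^{(\mathsf{nest}, \mathsf{cros}, \mathsf{cpk}^*,\mathsf{exc})}(\mathfrak{S}_n; p, q, x,t)=\left(\frac{1+u}{1+uv}\right)^{n-1}A_{n}(p, q, v),$$ where $u=\frac{1+t^{2}-2xt-(1-t)\sqrt{(1+t)^{2}-4xt}}{2(1-x)t}$ and $v=\frac{(1+t)^{2}-2xt-(1+t)\sqrt{(1+t)^{2}-4xt}}{2xt}$.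
   Context: $\mathfrak{S}_n$ is the set of permutations of $[n]=\{1,\dots,n\}$. For a finite set $\Omega$ of permutations and statistics $\mathsf{stat}_1,\dots,\mathsf{stat}_m$, $P^{(\mathsf{stat}_1,\ldots,\mathsf{stat}_m)}(\Omega;t_1,\ldots,t_m)=\sum_{\sigma\in\Omega}t_1^{\mathsf{stat}_1\sigma}\cdots t_m^{\mathsf{stat}_m\sigma}$. For $\sigma\in\mathfrak{S}_n$: $\mathsf{exc}\,\sigma=\#\{i:\sigma(i)>i\}$; for $i\in[n]$, $\mathsf{nest}_i\sigma=\#\{j: j<i<\sigma(i)<\sigma(j)\text{ or }\sigma(j)<\sigma(i)\le i<j\}$ and $\mathsf{cros}_i\sigma=\#\{j: j<i<\sigma(j)<\sigma(i)\text{ or }\sigma(i)<\sigma(j)\le i<j\}$; $\mathsf{nest}=\sum_i\mathsf{nest}_i$, $\mathsf{cros}=\sum_i\mathsf{cros}_i$. The star companion $\sigma^*$ is the permutation of $\{0,1,\dots,n\}$ with $\sigma^*(0)=n$ and $\sigma^*(i)=\sigma(i)-1$ for $i\in[n]$. Then $\mathsf{cpk}^*\sigma=\#\{i\in[n-1]:(\sigma^*)^{ -1}(i)<i>\sigma^*(i)\}$. -}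

module Defs where

open import Algebra.Bundles using (CommutativeRing)
open import Algebra.Definitions using (Invertible)
import Algebra.Properties.Semiring.Exp as Exp
open import Data.Fin.Base using (Fin; zero; suc; toℕ; fromℕ; inject₁; punchIn; _<_; _≤_)
open import Data.Fin.Permutation as Perm
  using (Permutation′; _⟨$⟩ʳ_; _⟨$⟩ˡ_; insert; remove; insert-punchIn; insert-remove)
open import Data.Fin.Properties
  using (_<?_; _≤?_; toℕ-fromℕ; toℕ-inject₁; punchIn-injective)
open import Data.List.Base using (List; []; _∷_; map; foldr; filter; length; allFin; cartesianProductWith)
open import Data.List.Membership.Propositional.Properties using (∈-allFin)
import Data.List.Relation.Unary.All as All
import Data.List.Relation.Unary.All.Properties as AllP
open import Data.List.Relation.Unary.AllPairs using (AllPairs; []; _∷_)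
import Data.List.Relation.Unary.AllPairs as AllPairs
import Data.List.Relation.Unary.AllPairs.Properties as AllPairsP
open import Data.List.Relation.Unary.Any using (Any; here)
import Data.List.Relation.Unary.Any.Properties as AnyP
import Data.List.Relation.Unary.Unique.Propositional.Properties as UniqueP
open import Data.Nat.Base as ℕ using (ℕ; zero; suc)
open import Data.Nat.ListAction using (sum)
import Data.Nat.Properties as ℕ
open import Data.Product.Base using (_×_; _,_; proj₁)
open import Data.Sum.Base using (_⊎_)
open import Data.Vec.Base as Vec using (Vec)
open import Function.Base using (_∘_)
open import Relation.Binary.PropositionalEquality
  using (_≡_; refl; sym; trans; cong)
open import Relation.Nullary using (¬_)
open import Relation.Nullary.Decidable using (_×-dec_; _⊎-dec_)
open import Relation.Unary using (Pred; Decidable)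

# : ∀ {n p} {P : Pred (Fin n) p} → Decidable P → ℕ
# {n} P? = length (filter P? (allFin n))

-- The set [n] is represented by Fin n, whose element i stands for toℕ i + 1.
-- The statistics exc, nest and cros only compare elements of [n] with each
-- other, so this shift does not affect them.

-- An enumeration of all permutations of Fin n: a permutation of Fin (suc n)
-- is given by the image j of zero and the pattern formed by the other images.
𝔖 : ∀ n → List (Permutation′ n)
𝔖 zero    = Perm.id ∷ []
𝔖 (suc n) = cartesianProductWith (insert zero) (allFin (suc n)) (𝔖 n)

exc : ∀ {n} → Permutation′ n → ℕ
exc σ = # (λ i → i <? σ ⟨$⟩ʳ i)

module _ {n} (σ : Permutation′ n) (i : Fin n) where

  Nesting : Fin n → Set
  Nesting j = (j < i × i < σ ⟨$⟩ʳ i × σ ⟨$⟩ʳ i < σ ⟨$⟩ʳ j)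
            ⊎ (σ ⟨$⟩ʳ j < σ ⟨$⟩ʳ i × σ ⟨$⟩ʳ i ≤ i × i < j)

  Crossing : Fin n → Set
  Crossing j = (j < i × i < σ ⟨$⟩ʳ j × σ ⟨$⟩ʳ j < σ ⟨$⟩ʳ i)
             ⊎ (σ ⟨$⟩ʳ i < σ ⟨$⟩ʳ j × σ ⟨$⟩ʳ j ≤ i × i < j)

  nesting? : Decidable Nesting
  nesting? j = (j <? i ×-dec i <? σ ⟨$⟩ʳ i ×-dec σ ⟨$⟩ʳ i <? σ ⟨$⟩ʳ j)
       ⊎-dec (σ ⟨$⟩ʳ j <? σ ⟨$⟩ʳ i ×-dec σ ⟨$⟩ʳ i ≤? i ×-dec i <? j)

  crossing? : Decidable Crossing
  crossing? j = (j <? i ×-dec i <? σ ⟨$⟩ʳ j ×-dec σ ⟨$⟩ʳ j <? σ ⟨$⟩ʳ i)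
        ⊎-dec (σ ⟨$⟩ʳ i <? σ ⟨$⟩ʳ j ×-dec σ ⟨$⟩ʳ j ≤? i ×-dec i <? j)

  nestᵢ : ℕ
  nestᵢ = # nesting?

  crosᵢ : ℕ
  crosᵢ = # crossing?

nest : ∀ {n} → Permutation′ n → ℕ
nest {n} σ = sum (map (nestᵢ σ) (allFin n))

cros : ∀ {n} → Permutation′ n → ℕ
cros {n} σ = sum (map (crosᵢ σ) (allFin n))

-- The star companion σ* = σ ⋆ acts on {0,…,n}; here k : Fin (suc n) stands for
-- toℕ k itself, so that suc i represents the same number as i : Fin n does
-- in [n].  See star-zero and star-suc below.
_⋆ : ∀ {n} → Permutation′ n → Permutation′ (suc n)
_⋆ {n} σ = insert zero (fromℕ n) σ

star-zero : ∀ {n} (σ : Permutation′ n) → toℕ ((σ ⋆) ⟨$⟩ʳ zero) ≡ n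
star-zero {n} σ = toℕ-fromℕ n

-- σ*(i) = σ(i) - 1: as an element of [n], σ(i) is suc (toℕ (σ ⟨$⟩ʳ i)).
star-suc : ∀ {n} (σ : Permutation′ n) (i : Fin n) →
           toℕ ((σ ⋆) ⟨$⟩ʳ suc i) ≡ toℕ (σ ⟨$⟩ʳ i)
star-suc {n} σ i =
  trans (cong toℕ (trans (insert-punchIn zero (fromℕ n) σ i) (punchIn-fromℕ (σ ⟨$⟩ʳ i))))
        (toℕ-inject₁ (σ ⟨$⟩ʳ i))
  where
  punchIn-fromℕ : ∀ {m} (k : Fin m) → punchIn (fromℕ m) k ≡ inject₁ k
  punchIn-fromℕ zero    = refl
  punchIn-fromℕ (suc k) = cong suc (punchIn-fromℕ k)

module _ {n} (σ : Permutation′ n) where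

  -- The first two conditions say i ∈ [n-1].
  CyclicPeak* : Fin (suc n) → Set
  CyclicPeak* i = 1 ℕ.≤ toℕ i × toℕ i ℕ.< n × (σ ⋆) ⟨$⟩ˡ i < i × (σ ⋆) ⟨$⟩ʳ i < i

  cyclicPeak*? : Decidable CyclicPeak*
  cyclicPeak*? i = 1 ℕ.≤? toℕ i ×-dec toℕ i ℕ.<? n
             ×-dec (σ ⋆) ⟨$⟩ˡ i <? i ×-dec (σ ⋆) ⟨$⟩ʳ i <? i

  cpk* : ℕ
  cpk* = # cyclicPeak*?

-- Identities between rational functions in indeterminates are stated for
-- arbitrary elements of an arbitrary commutative ring in which the
-- denominators are invertible; a / b takes the invertibility of b as an
-- instance argument.  A square root of D is any s with s ^ 2 ≈ D; taking the
-- ring to be a field of rational functions, with s adjoined, gives back the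
-- identities in the indeterminates themselves.
module Polynomials {c ℓ} (R : CommutativeRing c ℓ) where

  open CommutativeRing R using (0#; semiring)
  open CommutativeRing R public using (Carrier; _≈_; _+_; _-_; _*_; 1#)
  open Exp semiring public using (_^_)

  infixl 7 _/_

  Unit : Carrier → Set _
  Unit = Invertible _≈_ 1# _*_

  _/_ : (a b : Carrier) ⦃ _ : Unit b ⦄ → Carrier
  _/_ a b ⦃ b⁻¹ ⦄ = a * proj₁ b⁻¹

  2# : Carrier
  2# = 1# + 1#

  4# : Carrier
  4# = 2# + 2#

  ∑ : List Carrier → Carrier
  ∑ = foldr _+_ 0#

  ∏ : ∀ {m} → Vec Carrier m → Carrier
  ∏ = Vec.foldr′ _*_ 1#

  P : ∀ {m n} → Vec (Permutation′ n → ℕ) m → List (Permutation′ n) → Vec Carrier m → Carrier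
  P stats Ω ts = ∑ (map (λ σ → ∏ (Vec.zipWith (λ stat t → t ^ stat σ) stats ts)) Ω)

  A : ℕ → Carrier → Carrier → Carrier → Carrier
  A n p q t = ∑ (map (λ σ → p ^ nest σ * q ^ cros σ * t ^ exc σ) (𝔖 n))

-- The list 𝔖 n contains every permutation of Fin n exactly once, up to
-- pointwise equality.

private
  insert-cong : ∀ {n} j {σ τ : Permutation′ n} → σ Perm.≈ τ →
                insert zero j σ Perm.≈ insert zero j τ
  insert-cong j         σ≈τ zero    = refl
  insert-cong j {σ} {τ} σ≈τ (suc k) =
    trans (insert-punchIn zero j σ k)
      (trans (cong (punchIn j) (σ≈τ k)) (sym (insert-punchIn zero j τ k)))

  insert-injective : ∀ {n} j {σ τ : Permutation′ n} →
                     insert zero j σ Perm.≈ insert zero j τ → σ Perm.≈ τ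
  insert-injective j {σ} {τ} eq k = punchIn-injective j _ _
    (trans (sym (insert-punchIn zero j σ k)) (trans (eq (suc k)) (insert-punchIn zero j τ k)))

𝔖-complete : ∀ n (σ : Permutation′ n) → Any (σ Perm.≈_) (𝔖 n)
𝔖-complete zero    σ = here λ ()
𝔖-complete (suc n) σ =
  AnyP.cartesianProductWith⁺ (insert zero)
    (λ { {j} {τ} refl ρ≈τ k → trans (sym (insert-remove zero σ k)) (insert-cong j ρ≈τ k) })
    (∈-allFin (σ ⟨$⟩ʳ zero)) (𝔖-complete n (remove zero σ))

𝔖-unique : ∀ n → AllPairs (λ σ τ → ¬ (σ Perm.≈ τ)) (𝔖 n)
𝔖-unique zero    = All.[] ∷ []
𝔖-unique (suc n) = go (UniqueP.allFin⁺ (suc n))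
  where
  go : ∀ {js} → AllPairs (λ i j → ¬ (i ≡ j)) js →
       AllPairs (λ σ τ → ¬ (σ Perm.≈ τ)) (cartesianProductWith (insert zero) js (𝔖 n))
  go []                   = []
  go (_∷_ {j} {js} j∉ u) = AllPairsP.++⁺
    (AllPairsP.map⁺ (AllPairs.map (λ σ≉τ → σ≉τ ∘ insert-injective j) (𝔖-unique n)))
    (go u)
    (AllP.map⁺ (All.universal (λ _ → rest j∉) (𝔖 n)))
    where
    rest : ∀ {σ ks} → All.All (λ k → ¬ (j ≡ k)) ks →
           All.All (λ τ → ¬ (insert zero j σ Perm.≈ τ)) (cartesianProductWith (insert zero) ks (𝔖 n))
    rest All.[]         = All.[]
    rest (j≢k All.∷ r) = AllP.++⁺
      (AllP.map⁺ (All.universal (λ _ eq → j≢k (eq zero)) (𝔖 n))) (rest r)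

-- Scan a permutation from left to right, reading position i and then value i + 1 for each i < n.
-- The number m of open positions (positions read so far whose values are still to come) traces a
-- Motzkin path of length n - 1: position i is a non-excedance or is opened, and value i + 1 closes
-- an open position or does not, so there are two level steps, one up and one down step.  Choosing
-- one of k partners contributes the sum of pⁱ qʲ over i + j = k - 1 whether a value is chosen for a
-- non-excedance or a position for an excedance value, so both level steps get the same weight in
-- p and q; cpk* counts the down steps.  With x marking cpk* and t marking exc, the level steps
-- together carry the factor 1 + t, and an up step with its matching down step carries x t.  Hence
-- the enumerator depends on x and t only through 1 + t and x t, and replacing these by c (1 + t)
-- and c² x t multiplies it by cⁿ⁻¹.  Both formulas are instances of this.
module Submission where

open import Defs
open import Algebra.Bundles using (CommutativeRing)
import Algebra.Solver.Ring
open import Algebra.Solver.Ring.AlmostCommutativeRing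
  using (fromCommutativeRing; _-Raw-AlmostCommutative⟶_)
open import Data.Bool.Base using (true; false; if_then_else_)
open import Data.Fin.Base as Fin using (Fin; zero; suc; toℕ; fromℕ<; punchIn; punchOut)
open import Data.Fin.Permutation as Perm
  using (Permutation′; _⟨$⟩ʳ_; _⟨$⟩ˡ_; insert; remove; insert-punchIn; punchIn-permute)
import Data.Fin.Properties as Fin
open import Data.Integer.Base as ℤ using (ℤ; +_; -[1+_])
import Data.Integer.Properties as ℤ
open import Data.List.Base as List
  using (List; []; _∷_; _++_; allFin; cartesianProductWith; filter; length)
import Data.List.Properties as List
open import Data.Maybe.Base as Maybe using (Maybe)
open import Data.Nat.Base as ℕ using (ℕ; zero; suc; _≤_; _<_; _≥_; _∸_; z≤n; s≤s; s≤s⁻¹)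
open import Data.Nat.ListAction using () renaming (sum to sumᴸ)
import Data.Nat.Properties as ℕ
open import Data.Product.Base using (_×_; _,_; proj₁; proj₂; ∃)
open import Data.Sum.Base using (_⊎_; inj₁; inj₂; [_,_])
open import Data.Vec.Base using ([]; _∷_)
open import Function.Base using (_∘_; id)
open import Function.Bundles using (_⇔_; mk⇔; Equivalence; Injection)
open import Function.Construct.Identity using (⇔-id)
open import Function.Properties.Inverse using (↔⇒↣)
open import Relation.Binary.PropositionalEquality as ≡
  using (_≡_; _≗_; cong; cong₂; subst; subst₂)
open import Relation.Nullary using (¬_; Dec; yes; no; does; contradiction)
open import Relation.Nullary.Decidable
  using (_×-dec_; _⊎-dec_; _→-dec_; does-⇔; dec-true; dec-false; dec⇒maybe)

open import Algebra.Properties.Semiring.Sum ℕ.+-*-semiring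
  using (sum; sum-remove; sum-cong-≋; ∑-distrib-+; sum-replicate-zero; sum-permute)

open Equivalence using (to; from)

-- Permutation statistics as sums over pairs of points

private
  variable
    n : ℕ

ι : ∀ {ℓ} {A : Set ℓ} → Dec A → ℕ
ι A? = if does A? then 1 else 0

ι-cong : ∀ {ℓ ℓ′} {A : Set ℓ} {B : Set ℓ′} (A? : Dec A) (B? : Dec B) → A ⇔ B → ι A? ≡ ι B?
ι-cong A? B? A⇔B = cong (if_then 1 else 0) (does-⇔ A⇔B A? B?)

ι-false : ∀ {ℓ} {A : Set ℓ} (A? : Dec A) → ¬ A → ι A? ≡ 0
ι-false A? ¬A = cong (if_then 1 else 0) (dec-false A? ¬A)

ι-true : ∀ {ℓ} {A : Set ℓ} (A? : Dec A) → A → ι A? ≡ 1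
ι-true A? A = cong (if_then 1 else 0) (dec-true A? A)

sum-cong : {f g : Fin n → ℕ} → f ≗ g → sum f ≡ sum g
sum-cong = sum-cong-≋

count : ∀ {ℓ} {Q : Fin n → Set ℓ} → (∀ k → Dec (Q k)) → ℕ
count Q? = sum λ k → ι (Q? k)

sum-map-allFin : (f : Fin n → ℕ) → sumᴸ (List.map f (allFin n)) ≡ sum f
sum-map-allFin {zero}  f = ≡.refl
sum-map-allFin {suc n} f = cong (f zero ℕ.+_)
  (≡.trans (cong sumᴸ (≡.trans (List.map-tabulate suc f) (≡.sym (List.map-tabulate id (f ∘ suc)))))
         (sum-map-allFin (f ∘ suc)))

#≡count : ∀ {ℓ} {Q : Fin n → Set ℓ} (Q? : ∀ k → Dec (Q k)) → # Q? ≡ count Q?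
#≡count {n} Q? = ≡.trans (go (allFin n)) (sum-map-allFin (λ k → ι (Q? k)))
  where
  go : ∀ ks → length (filter Q? ks) ≡ sumᴸ (List.map (λ k → ι (Q? k)) ks)
  go []       = ≡.refl
  go (k ∷ ks) with does (Q? k)
  ... | true  = cong suc (go ks)
  ... | false = go ks

-- A relation between two points (i, v) and (j, w) of the graph of a permutation.
PointRel : Set₁
PointRel = (i v j w : ℕ) → Set

Nests Crosses Peaks : PointRel
Nests   i v j w = (j < i × i < v × v < w) ⊎ (w < v × v ≤ i × i < j)
Crosses i v j w = (j < i × i < w × w < v) ⊎ (v < w × w ≤ i × i < j)
-- With 0-based indices, the cyclic peaks of σ* are the i with σ(i) ≤ i and
-- σ⁻¹(i + 1) < i; here j stands for σ⁻¹(i + 1).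
Peaks   i v j w = v ≤ i × j < i × w ≡ suc i

PointDec : PointRel → Set
PointDec ρ = ∀ i v j w → Dec (ρ i v j w)

nests? : PointDec Nests
nests? i v j w = (j ℕ.<? i ×-dec i ℕ.<? v ×-dec v ℕ.<? w)
           ⊎-dec (w ℕ.<? v ×-dec v ℕ.≤? i ×-dec i ℕ.<? j)

crosses? : PointDec Crosses
crosses? i v j w = (j ℕ.<? i ×-dec i ℕ.<? w ×-dec w ℕ.<? v)
             ⊎-dec (v ℕ.<? w ×-dec w ℕ.≤? i ×-dec i ℕ.<? j)

peaks? : PointDec Peaks
peaks? i v j w = v ℕ.≤? i ×-dec j ℕ.<? i ×-dec w ℕ.≟ suc i

module _ {ρ : PointRel} (ρ? : PointDec ρ) where

  related : (σ : Permutation′ n) (i j : Fin n) → ℕ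
  related σ i j = ι (ρ? (toℕ i) (toℕ (σ ⟨$⟩ʳ i)) (toℕ j) (toℕ (σ ⟨$⟩ʳ j)))

  pairs : Permutation′ n → ℕ
  pairs σ = sum λ i → sum (related σ i)

  pairs-cong : {σ τ : Permutation′ n} → σ Perm.≈ τ → pairs σ ≡ pairs τ
  pairs-cong σ≈τ = sum-cong λ i → sum-cong λ j →
    cong₂ (λ v w → ι (ρ? (toℕ i) (toℕ v) (toℕ j) (toℕ w))) (σ≈τ i) (σ≈τ j)

excs : Permutation′ n → ℕ
excs σ = count λ i → toℕ i ℕ.<? toℕ (σ ⟨$⟩ʳ i)

nest≡pairs : (σ : Permutation′ n) → nest σ ≡ pairs nests? σ
nest≡pairs σ = ≡.trans (sum-map-allFin (nestᵢ σ)) (sum-cong λ i → #≡count (nesting? σ i))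

cros≡pairs : (σ : Permutation′ n) → cros σ ≡ pairs crosses? σ
cros≡pairs σ = ≡.trans (sum-map-allFin (crosᵢ σ)) (sum-cong λ i → #≡count (crossing? σ i))

exc≡excs : (σ : Permutation′ n) → exc σ ≡ excs σ
exc≡excs σ = #≡count (λ i → i Fin.<? σ ⟨$⟩ʳ i)

-- When a point is inserted at `a`, the pairs of points are the new point with itself, the new point
-- with an old one in either order, and two old points. The three summands follow this division.
sum-sum-remove : ∀ (F : Fin (suc n) → Fin (suc n) → ℕ) a →
  sum (λ i → sum (F i))
    ≡ F a a ℕ.+ (sum (λ k → F a (punchIn a k) ℕ.+ F (punchIn a k) a)
               ℕ.+ sum (λ k → sum λ l → F (punchIn a k) (punchIn a l)))
sum-sum-remove F a = begin
  sum (λ i → sum (F i))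
    ≡⟨ sum-remove {i = a} (λ i → sum (F i)) ⟩
  sum (F a) ℕ.+ sum (λ k → sum (F (punchIn a k)))
    ≡⟨ cong₂ ℕ._+_ (sum-remove {i = a} (F a)) (sum-cong λ k → sum-remove {i = a} (F (punchIn a k))) ⟩
  (F a a ℕ.+ r) ℕ.+ sum (λ k → F (punchIn a k) a ℕ.+ sum λ l → F (punchIn a k) (punchIn a l))
    ≡⟨ cong ((F a a ℕ.+ r) ℕ.+_) (∑-distrib-+ (λ k → F (punchIn a k) a) _) ⟩
  (F a a ℕ.+ r) ℕ.+ (c ℕ.+ s)
    ≡⟨ ℕ.+-assoc (F a a) r (c ℕ.+ s) ⟩
  F a a ℕ.+ (r ℕ.+ (c ℕ.+ s))
    ≡⟨ cong (F a a ℕ.+_) (ℕ.+-assoc r c s) ⟨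
  F a a ℕ.+ ((r ℕ.+ c) ℕ.+ s)
    ≡⟨ cong (λ e → F a a ℕ.+ (e ℕ.+ s)) (∑-distrib-+ (λ k → F a (punchIn a k)) _) ⟨
  _ ∎
  where
  open ≡.≡-Reasoning
  r = sum λ k → F a (punchIn a k)
  c = sum λ k → F (punchIn a k) a
  s = sum λ k → sum λ l → F (punchIn a k) (punchIn a l)

insert-self : ∀ (a b : Fin (suc n)) (τ : Permutation′ n) → insert a b τ ⟨$⟩ʳ a ≡ b
insert-self a b τ with a Fin.≟ a
... | yes _   = ≡.refl
... | no  a≢a = contradiction ≡.refl a≢a

module _ {ρ : PointRel} (ρ? : PointDec ρ) (a b : Fin (suc n)) (τ : Permutation′ n) where

  private
    pos val : Fin n → ℕ
    pos k = toℕ (punchIn a k)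
    val k = toℕ (punchIn b (τ ⟨$⟩ʳ k))

  -- The last hypothesis says that shifting indices preserves the relation between old points, so
  -- these contribute the statistic of `τ`. What the insertion adds is the contribution `g k` of
  -- each old point paired with the new one.
  pairs-insert : ∀ {g : Fin n → ℕ} →
    ¬ ρ (toℕ a) (toℕ b) (toℕ a) (toℕ b) →
    (∀ k → ι (ρ? (toℕ a) (toℕ b) (pos k) (val k)) ℕ.+ ι (ρ? (pos k) (val k) (toℕ a) (toℕ b)) ≡ g k) →
    (∀ k l → ρ (toℕ k) (toℕ (τ ⟨$⟩ʳ k)) (toℕ l) (toℕ (τ ⟨$⟩ʳ l)) ⇔ ρ (pos k) (val k) (pos l) (val l)) →
    pairs ρ? (insert a b τ) ≡ sum g ℕ.+ pairs ρ? τ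
  pairs-insert {g} ¬diag edge inner = begin
    pairs ρ? (insert a b τ)
      ≡⟨ sum-sum-remove (related ρ? σ) a ⟩
    related ρ? σ a a ℕ.+ _
      ≡⟨ cong₂ ℕ._+_ diag (cong₂ ℕ._+_ (sum-cong λ k → ≡.trans (cong₂ ℕ._+_ (row k) (col k)) (edge k))
                                    (sum-cong λ k → sum-cong λ l → minor k l)) ⟩
    sum g ℕ.+ pairs ρ? τ ∎
    where
    open ≡.≡-Reasoning
    σ = insert a b τ
    σa : toℕ (σ ⟨$⟩ʳ a) ≡ toℕ b
    σa = cong toℕ (insert-self a b τ)
    σk : ∀ k → toℕ (σ ⟨$⟩ʳ punchIn a k) ≡ val k
    σk k = cong toℕ (insert-punchIn a b τ k)
    diag : related ρ? σ a a ≡ 0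
    diag = ≡.trans (cong (λ v → ι (ρ? (toℕ a) v (toℕ a) v)) σa) (ι-false (ρ? _ _ _ _) ¬diag)
    row : ∀ k → related ρ? σ a (punchIn a k) ≡ ι (ρ? (toℕ a) (toℕ b) (pos k) (val k))
    row k = cong₂ (λ v w → ι (ρ? (toℕ a) v (pos k) w)) σa (σk k)
    col : ∀ k → related ρ? σ (punchIn a k) a ≡ ι (ρ? (pos k) (val k) (toℕ a) (toℕ b))
    col k = cong₂ (λ v w → ι (ρ? (pos k) v (toℕ a) w)) (σk k) σa
    minor : ∀ k l → related ρ? σ (punchIn a k) (punchIn a l) ≡ related ρ? τ k l
    minor k l = ≡.trans (cong₂ (λ v w → ι (ρ? (pos k) v (pos l) w)) (σk k) (σk l))
                      (≡.sym (ι-cong (ρ? _ _ _ _) (ρ? _ _ _ _) (inner k l)))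

excs-insert : ∀ (a b : Fin (suc n)) (τ : Permutation′ n) →
  (∀ k → toℕ k < toℕ (τ ⟨$⟩ʳ k) ⇔ toℕ (punchIn a k) < toℕ (punchIn b (τ ⟨$⟩ʳ k))) →
  excs (insert a b τ) ≡ ι (toℕ a ℕ.<? toℕ b) ℕ.+ excs τ
excs-insert a b τ inner = ≡.trans
  (sum-remove {i = a} (λ i → ι (toℕ i ℕ.<? toℕ (insert a b τ ⟨$⟩ʳ i))))
  (cong₂ ℕ._+_ (cong (λ v → ι (toℕ a ℕ.<? toℕ v)) (insert-self a b τ))
    (sum-cong λ k → ≡.trans
      (cong (λ v → ι (toℕ (punchIn a k) ℕ.<? toℕ v)) (insert-punchIn a b τ k))
      (≡.sym (ι-cong (_ ℕ.<? _) (_ ℕ.<? _) (inner k)))))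

-- Order relations under insertion and deletion of a point

-- The graph of `punchIn a` on natural numbers; a case split on it replaces the shifted index by `k`
-- or `suc k`.
data PunchIn (a k : ℕ) : ℕ → Set where
  below : k < a → PunchIn a k k
  above : a ≤ k → PunchIn a k (suc k)

punchIn-view : ∀ (a : Fin (suc n)) (k : Fin n) → PunchIn (toℕ a) (toℕ k) (toℕ (punchIn a k))
punchIn-view zero    k       = above z≤n
punchIn-view (suc a) zero    = below (s≤s z≤n)
punchIn-view (suc a) (suc k) with toℕ (punchIn a k) | punchIn-view a k
... | _ | below k<a = below (s≤s k<a)
... | _ | above a≤k = above (s≤s a≤k)

module _ {a : ℕ} where

  PunchIn-mono-< : ∀ {k l K L} → PunchIn a k K → PunchIn a l L → k < l → K < L
  PunchIn-mono-< (below _)   (below _)   k<l = k<l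
  PunchIn-mono-< (below _)   (above _)   k<l = ℕ.m<n⇒m<1+n k<l
  PunchIn-mono-< (above a≤k) (below l<a) k<l = contradiction l<a (ℕ.≤⇒≯ (ℕ.≤-trans a≤k (ℕ.<⇒≤ k<l)))
  PunchIn-mono-< (above _)   (above _)   k<l = s≤s k<l

  PunchIn-mono-≤ : ∀ {k l K L} → PunchIn a k K → PunchIn a l L → k ≤ l → K ≤ L
  PunchIn-mono-≤ (below _)   (below _)   k≤l = k≤l
  PunchIn-mono-≤ (below _)   (above _)   k≤l = ℕ.m≤n⇒m≤1+n k≤l
  PunchIn-mono-≤ (above a≤k) (below l<a) k≤l = contradiction l<a (ℕ.≤⇒≯ (ℕ.≤-trans a≤k k≤l))
  PunchIn-mono-≤ (above _)   (above _)   k≤l = s≤s k≤l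

  PunchIn-<⇔ : ∀ {k l K L} → PunchIn a k K → PunchIn a l L → k < l ⇔ K < L
  PunchIn-<⇔ p q = mk⇔ (PunchIn-mono-< p q)
    λ K<L → ℕ.≰⇒> λ l≤k → ℕ.<⇒≱ K<L (PunchIn-mono-≤ q p l≤k)

  PunchIn-increasing : ∀ {k K} → PunchIn a k K → k ≤ K
  PunchIn-increasing (below _) = ℕ.≤-refl
  PunchIn-increasing (above _) = ℕ.n≤1+n _

  PunchIn-≤suc : ∀ {k K} → PunchIn a k K → K ≤ suc k
  PunchIn-≤suc (below _) = ℕ.n≤1+n _
  PunchIn-≤suc (above _) = ℕ.≤-refl

  PunchIn-above : ∀ {k K} → PunchIn a k K → a ≤ k → K ≡ suc k
  PunchIn-above (below k<a) a≤k = contradiction k<a (ℕ.≤⇒≯ a≤k)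
  PunchIn-above (above _)   _   = ≡.refl

  PunchIn-<⁻ : ∀ {k K} → PunchIn a k K → K < a → k < a
  PunchIn-<⁻ (below k<a) _ = k<a
  PunchIn-<⁻ (above a≤k) k<a = contradiction (ℕ.≤-trans a≤k (ℕ.n≤1+n _)) (ℕ.<⇒≱ k<a)

  PunchIn-<⁺ : ∀ {k K} → PunchIn a k K → k < a → K < a
  PunchIn-<⁺ (below k<a) _ = k<a
  PunchIn-<⁺ (above a≤k) k<a = contradiction a≤k (ℕ.<⇒≱ k<a)

  PunchIn->⁻ : ∀ {k K} → PunchIn a k K → a < K → a ≤ k
  PunchIn->⁻ (below k<a) a<k = contradiction a<k (ℕ.<⇒≯ k<a)
  PunchIn->⁻ (above a≤k) _ = a≤k

  PunchIn->⁺ : ∀ {k K} → PunchIn a k K → a ≤ k → a < K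
  PunchIn->⁺ (below k<a) a≤k = contradiction a≤k (ℕ.<⇒≱ k<a)
  PunchIn->⁺ (above a≤k) _ = s≤s a≤k

-- Scanning positions and values from left to right, delete the points already met.  What is
-- left after meeting all points with position < i and value ≤ i is a permutation σ whose first
-- m positions are open: their values are still to come.  This is Opens m (m + 1) σ right
-- before a position is read, and Opens m m σ right before a value is read.
Opens : (m θ : ℕ) → Permutation′ n → Set
Opens m θ σ = ∀ k → toℕ k < m → θ ≤ toℕ (σ ⟨$⟩ʳ k)

≤⇔≤ : ∀ {i v I V} → (i < v ⇔ I < V) → v ≤ i ⇔ V ≤ I
≤⇔≤ e = mk⇔ (λ v≤i → ℕ.≮⇒≥ (λ I<V → ℕ.<⇒≱ (from e I<V) v≤i))
            (λ V≤I → ℕ.≮⇒≥ (λ i<v → ℕ.<⇒≱ (to e i<v) V≤I))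

-- Deleting the point (a, b) from a permutation keeps the relative order of positions and
-- values, and also the comparison of a position i with a value w as soon as i < m → θ ≤ w.
module Deletion {a b m θ : ℕ} (a≤m : a ≤ m) (b≤θ : b ≤ θ) (m≤θ : m ≤ θ) (b≤1+m : b ≤ suc m) where

  -- For i < m both inequalities hold, because i < m ≤ θ ≤ w. For i ≥ m the position is shifted;
  -- then either w is shifted too, or w < b ≤ m + 1 gives w ≤ i and both inequalities fail.
  mixed : ∀ {i I w W} → PunchIn a i I → PunchIn b w W → (i < m → θ ≤ w) → i < w ⇔ I < W
  mixed {i} {I} {w} pi pw h with i ℕ.<? m
  ... | yes i<m = mk⇔ (λ _ → I<W) (λ _ → ℕ.<-≤-trans i<m (ℕ.≤-trans m≤θ (h i<m)))
    where
    I<W : I < _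
    I<W = ℕ.≤-<-trans (ℕ.≤-trans (PunchIn-≤suc pi) (ℕ.<-≤-trans i<m (ℕ.≤-trans m≤θ (h i<m))))
                      (ℕ.≤-reflexive (≡.sym (PunchIn-above pw (ℕ.≤-trans b≤θ (h i<m)))))
  ... | no i≮m with PunchIn-above pi (ℕ.≤-trans a≤m (ℕ.≮⇒≥ i≮m)) | pw
  ...   | ≡.refl | above _   = mk⇔ s≤s s≤s⁻¹
  ...   | ≡.refl | below w<b = mk⇔ (λ i<w → contradiction i<w (ℕ.≤⇒≯ w≤i))
                                 (λ i<w → contradiction (ℕ.<-trans (ℕ.n<1+n i) i<w) (ℕ.≤⇒≯ w≤i))
    where
    w≤i : w ≤ i
    w≤i = ℕ.≤-trans (s≤s⁻¹ (ℕ.≤-trans w<b b≤1+m)) (ℕ.≮⇒≥ i≮m)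

  successor : ∀ {i I w W} → PunchIn a i I → PunchIn b w W → m ≤ i → w ≡ suc i ⇔ W ≡ suc I
  successor {i} {I} {w} pi pw m≤i with PunchIn-above pi (ℕ.≤-trans a≤m m≤i) | pw
  ... | ≡.refl | above _   = mk⇔ (cong suc) ℕ.suc-injective
  ... | ≡.refl | below w<b = mk⇔ (λ w≡ → contradiction (ℕ.≤-reflexive (≡.sym w≡)) (ℕ.≤⇒≯ w≤i))
                               (λ w≡ → contradiction (ℕ.≤-trans (ℕ.n≤1+n _) (ℕ.≤-reflexive (≡.sym w≡))) (ℕ.≤⇒≯ w≤i))
    where
    w≤i : w ≤ i
    w≤i = ℕ.≤-trans (s≤s⁻¹ (ℕ.≤-trans w<b b≤1+m)) m≤i

  module _ {i v j w I V J W : ℕ}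
           (pi : PunchIn a i I) (pv : PunchIn b v V) (pj : PunchIn a j J) (pw : PunchIn b w W)
           (hi : i < m → θ ≤ v) (hj : j < m → θ ≤ w) where

    private
      module J<I = Equivalence (PunchIn-<⇔ pj pi)
      module I<J = Equivalence (PunchIn-<⇔ pi pj)
      module V<W = Equivalence (PunchIn-<⇔ pv pw)
      module W<V = Equivalence (PunchIn-<⇔ pw pv)
      module I<V = Equivalence (mixed pi pv hi)
      module V≤I = Equivalence (≤⇔≤ (mixed pi pv hi))

      -- Comparing the position of one point with the value of the other needs the bound θ ≤ w when
      -- i is open. If j < i, then j is open as well and supplies it; if v < w, it follows from θ ≤
      -- v.
      module I<W (j<i : j < i) = Equivalence (mixed pi pw (λ i<m → hj (ℕ.<-trans j<i i<m)))
      module W≤I (v<w : v < w) =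
        Equivalence (≤⇔≤ (mixed pi pw (λ i<m → ℕ.≤-trans (hi i<m) (ℕ.<⇒≤ v<w))))

    nests⇔ : Nests i v j w ⇔ Nests I V J W
    nests⇔ = mk⇔
      (λ { (inj₁ (x , y , z)) → inj₁ (J<I.to x , I<V.to y , V<W.to z)
         ; (inj₂ (x , y , z)) → inj₂ (W<V.to x , V≤I.to y , I<J.to z) })
      (λ { (inj₁ (x , y , z)) → inj₁ (J<I.from x , I<V.from y , V<W.from z)
         ; (inj₂ (x , y , z)) → inj₂ (W<V.from x , V≤I.from y , I<J.from z) })

    crosses⇔ : Crosses i v j w ⇔ Crosses I V J W
    crosses⇔ = mk⇔
      (λ { (inj₁ (x , y , z)) → inj₁ (J<I.to x , I<W.to x y , W<V.to z)
         ; (inj₂ (x , y , z)) → inj₂ (V<W.to x , W≤I.to x y , I<J.to z) })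
      (λ { (inj₁ (x , y , z)) → inj₁ (J<I.from x , I<W.from (J<I.from x) y , W<V.from z)
         ; (inj₂ (x , y , z)) → inj₂ (V<W.from x , W≤I.from (V<W.from x) y , I<J.from z) })

    peaks⇔ : Peaks i v j w ⇔ Peaks I V J W
    peaks⇔ = mk⇔
      (λ (x , y , z) → V≤I.to x , J<I.to y , to (successor pi pw (m≤i x)) z)
      (λ (x , y , z) → V≤I.from x , J<I.from y , from (successor pi pw (m≤i (V≤I.from x))) z)
      where
      -- An open position has a value beyond itself, so a non-excedance lies at or after m, where
      -- `successor` applies.
      m≤i : v ≤ i → m ≤ i
      m≤i v≤i = ℕ.≮⇒≥ λ i<m → ℕ.<⇒≱ (ℕ.<-≤-trans i<m (ℕ.≤-trans m≤θ (hi i<m))) v≤i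

-- Cyclic peaks as pairs

sum-zero : {f : Fin n → ℕ} → (∀ k → f k ≡ 0) → sum f ≡ 0
sum-zero {n} f≡0 = ≡.trans (sum-cong f≡0) (sum-replicate-zero n)

count-unique : ∀ {ℓ} {Q : Fin n → Set ℓ} (Q? : ∀ k → Dec (Q k)) →
               (∀ {k l} → Q k → Q l → k ≡ l) → count Q? ≡ ι (Fin.any? Q?)
count-unique {n} Q? unique with Fin.any? Q?
... | no ¬∃ = sum-zero λ k → ι-false (Q? k) (λ q → ¬∃ (k , q))
count-unique {suc n} Q? unique | yes (k , q) = ≡.trans (sum-remove {i = k} (ι ∘ Q?))
  (cong₂ ℕ._+_ (ι-true (Q? k) q)
             (sum-zero λ l → ι-false (Q? _) (λ q′ → Fin.punchInᵢ≢i k l (unique q′ q))))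

⟨$⟩ʳ-injective : (σ : Permutation′ n) {k l : Fin n} → toℕ (σ ⟨$⟩ʳ k) ≡ toℕ (σ ⟨$⟩ʳ l) → k ≡ l
⟨$⟩ʳ-injective σ eq = Injection.injective (↔⇒↣ σ) (Fin.toℕ-injective eq)

-- A peak of σ* at c + 1 has the single partner d with σ(d) = c + 1, unique because σ is injective.
-- Counting the pairs therefore counts the peaks.
cpk*≡pairs : (σ : Permutation′ n) → cpk* σ ≡ pairs peaks? σ
-- The term of the sum at index zero computes to 0, as 1 ≤ 0 is refuted, which leaves the indices
-- `suc c`.
cpk*≡pairs {n} σ = ≡.trans (#≡count (cyclicPeak*? σ)) (sum-cong λ c → ≡.trans
    (ι-cong (cyclicPeak*? σ (suc c)) (Fin.any? (peak? c)) (peak⇔ c))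
    (≡.sym (count-unique (peak? c) (λ p q →
      ⟨$⟩ʳ-injective σ (≡.trans (proj₂ (proj₂ p)) (≡.sym (proj₂ (proj₂ q))))))))
  where
  Peak : Fin n → Fin n → Set
  Peak c d = Peaks (toℕ c) (toℕ (σ ⟨$⟩ʳ c)) (toℕ d) (toℕ (σ ⟨$⟩ʳ d))
  peak? : ∀ c d → Dec (Peak c d)
  peak? c d = peaks? _ _ _ _
  peak⇔ : ∀ c → CyclicPeak* σ (suc c) ⇔ ∃ (Peak c)
  peak⇔ c = mk⇔ ⇒ ⇐
    where
    ⇒ : CyclicPeak* σ (suc c) → ∃ (Peak c)
    ⇒ (_ , c<n , l , r) with (σ ⋆) ⟨$⟩ˡ suc c in eq
    -- The preimage 0 would give c + 1 = σ*(0) = n, against c + 1 < n.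
    ... | zero  = contradiction
      (≡.trans (≡.sym (star-zero σ)) (cong toℕ (≡.trans (cong ((σ ⋆) ⟨$⟩ʳ_) (≡.sym eq)) (Perm.inverseʳ (σ ⋆)))))
      (ℕ.>⇒≢ c<n)
    ... | suc d = d , ℕ.≤-trans (ℕ.≤-reflexive (≡.sym (star-suc σ c))) (s≤s⁻¹ r) , s≤s⁻¹ l ,
      ≡.trans (≡.sym (star-suc σ d))
            (cong toℕ (≡.trans (cong ((σ ⋆) ⟨$⟩ʳ_) (≡.sym eq)) (Perm.inverseʳ (σ ⋆))))
    ⇐ : ∃ (Peak c) → CyclicPeak* σ (suc c)
    ⇐ (d , σc≤c , d<c , σd≡) =
        s≤s z≤n , subst (_< n) σd≡ (Fin.toℕ<n _)
      , subst (λ k → toℕ k < suc (toℕ c)) (≡.sym ⋆ˡ) (s≤s d<c)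
      , s≤s (ℕ.≤-trans (ℕ.≤-reflexive (star-suc σ c)) σc≤c)
      where
      ⋆ˡ : (σ ⋆) ⟨$⟩ˡ suc c ≡ suc d
      ⋆ˡ = ≡.trans (cong ((σ ⋆) ⟨$⟩ˡ_) (Fin.toℕ-injective (≡.sym (≡.trans (star-suc σ d) σd≡))))
                 (Perm.inverseˡ (σ ⋆))

-- The effect of an inserted point on the statistics

count-permute : ∀ {ℓ} {Q : Fin n → Set ℓ} (Q? : ∀ k → Dec (Q k)) (τ : Permutation′ n) →
                count (λ k → Q? (τ ⟨$⟩ʳ k)) ≡ count Q?
count-permute Q? τ = ≡.sym (sum-permute (ι ∘ Q?) τ)

-- For b ≤ m ≤ n, `smaller n b` is b and `between n b m` is m - b. They are kept as counts because
-- what matters is that both kinds of insertion produce the same two expressions.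
smaller : (n b : ℕ) → ℕ
smaller n b = count {n} λ k → toℕ k ℕ.<? b

between : (n b m : ℕ) → ℕ
between n b m = count {n} λ k → b ℕ.≤? toℕ k ×-dec toℕ k ℕ.<? m

-- The new point and an old one form two ordered pairs, and for each relation at most one of the two
-- orders can occur.
edge-first : ∀ {ℓ ℓ′ ℓ″} {A : Set ℓ} {B : Set ℓ′} {Q : Set ℓ″} (A? : Dec A) (B? : Dec B) (Q? : Dec Q) →
             A ⇔ Q → ¬ B → ι A? ℕ.+ ι B? ≡ ι Q?
edge-first A? B? Q? A⇔Q ¬B =
  ≡.trans (cong₂ ℕ._+_ (ι-cong A? Q? A⇔Q) (ι-false B? ¬B)) (ℕ.+-identityʳ _)

edge-second : ∀ {ℓ ℓ′ ℓ″} {A : Set ℓ} {B : Set ℓ′} {Q : Set ℓ″} (A? : Dec A) (B? : Dec B) (Q? : Dec Q) →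
              ¬ A → B ⇔ Q → ι A? ℕ.+ ι B? ≡ ι Q?
edge-second A? B? Q? ¬A B⇔Q = cong₂ ℕ._+_ (ι-false A? ¬A) (ι-cong B? Q? B⇔Q)

edge-none : ∀ {ℓ ℓ′} {A : Set ℓ} {B : Set ℓ′} (A? : Dec A) (B? : Dec B) → ¬ A → ¬ B → ι A? ℕ.+ ι B? ≡ 0
edge-none A? B? ¬A ¬B = cong₂ ℕ._+_ (ι-false A? ¬A) (ι-false B? ¬B)

¬Nests-self : ∀ {i v} → ¬ Nests i v i v
¬Nests-self (inj₁ (i<i , _)) = ℕ.<-irrefl ≡.refl i<i
¬Nests-self (inj₂ (v<v , _)) = ℕ.<-irrefl ≡.refl v<v

¬Crosses-self : ∀ {i v} → ¬ Crosses i v i v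
¬Crosses-self (inj₁ (i<i , _)) = ℕ.<-irrefl ≡.refl i<i
¬Crosses-self (inj₂ (v<v , _)) = ℕ.<-irrefl ≡.refl v<v

¬Peaks-self : ∀ {i v} → ¬ Peaks i v i v
¬Peaks-self (_ , i<i , _) = ℕ.<-irrefl ≡.refl i<i

closes? : ∀ m (τ : Permutation′ n) k → Dec (toℕ k < m × toℕ (τ ⟨$⟩ʳ k) ≡ m)
closes? m τ k = toℕ k ℕ.<? m ×-dec toℕ (τ ⟨$⟩ʳ k) ℕ.≟ m

-- Supplies the hypothesis on old points in `pairs-insert` and `excs-insert`, for both kinds of
-- insertion.
module Inserted (a b : Fin (suc n)) {m θ : ℕ}
         (a≤m : toℕ a ≤ m) (b≤θ : toℕ b ≤ θ) (m≤θ : m ≤ θ) (b≤1+m : toℕ b ≤ suc m)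
         (τ : Permutation′ n) (opens : Opens m θ τ) where

  open Deletion a≤m b≤θ m≤θ b≤1+m

  posV : ∀ k → PunchIn (toℕ a) (toℕ k) (toℕ (punchIn a k))
  posV = punchIn-view a
  valV : ∀ k → PunchIn (toℕ b) (toℕ (τ ⟨$⟩ʳ k)) (toℕ (punchIn b (τ ⟨$⟩ʳ k)))
  valV k = punchIn-view b (τ ⟨$⟩ʳ k)

  nests-inner : ∀ k l → _
  nests-inner k l = nests⇔ (posV k) (valV k) (posV l) (valV l) (opens k) (opens l)
  crosses-inner : ∀ k l → _
  crosses-inner k l = crosses⇔ (posV k) (valV k) (posV l) (valV l) (opens k) (opens l)
  peaks-inner : ∀ k l → _
  peaks-inner k l = peaks⇔ (posV k) (valV k) (posV l) (valV l) (opens k) (opens l)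
  excs-inner : ∀ k → _
  excs-inner k = mixed (posV k) (valV k) (opens k)

-- The new point is the non-excedance (m, b), preceded by m open positions. Old values below m
-- therefore lie to its right: those below b are nested with it, and those from b to m - 1 cross it.
-- It is a peak when an open position has value m, which the insertion turns into m + 1.
module NonExcedanceEdges {m b i v I V : ℕ} (b≤m : b ≤ m)
         (p : PunchIn m i I) (q : PunchIn b v V) (h : i < m → m ≤ v) where

  private
    m≤i : v < m → m ≤ i
    m≤i v<m = ℕ.≮⇒≥ λ i<m → ℕ.<⇒≱ v<m (h i<m)
    v<m : V ≤ I → I < m → v < m
    v<m V≤I I<m = ℕ.≤-<-trans (PunchIn-increasing q) (ℕ.≤-<-trans V≤I I<m)
    absurd : V ≤ I → ¬ (I < m)
    absurd V≤I I<m = ℕ.<⇒≱ (PunchIn-<⁻ p I<m) (m≤i (v<m V≤I I<m))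

  nests₁ : Nests m b I V ⇔ v < b
  nests₁ = mk⇔
    (λ { (inj₁ (_ , m<b , _)) → contradiction m<b (ℕ.≤⇒≯ b≤m)
       ; (inj₂ (V<b , _)) → PunchIn-<⁻ q V<b })
    (λ v<b → inj₂ (PunchIn-<⁺ q v<b , b≤m , PunchIn->⁺ p (m≤i (ℕ.<-≤-trans v<b b≤m))))

  nests₂ : ¬ Nests I V m b
  nests₂ (inj₁ (m<I , I<V , V<b)) = ℕ.<⇒≱ (ℕ.<-trans m<I (ℕ.<-trans I<V V<b)) b≤m
  nests₂ (inj₂ (_ , V≤I , I<m))   = absurd V≤I I<m

  crosses₁ : Crosses m b I V ⇔ (b ≤ v × v < m)
  crosses₁ = mk⇔
    (λ { (inj₁ (_ , m<V , V<b)) → contradiction b≤m (ℕ.<⇒≱ (ℕ.<-trans m<V V<b))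
       ; (inj₂ (b<V , V≤m , _)) → PunchIn->⁻ q b<V ,
           subst (_≤ m) (PunchIn-above q (PunchIn->⁻ q b<V)) V≤m })
    (λ (b≤v , v<m) → inj₂ (PunchIn->⁺ q b≤v , subst (_≤ m) (≡.sym (PunchIn-above q b≤v)) v<m ,
                            PunchIn->⁺ p (m≤i v<m)))

  crosses₂ : ¬ Crosses I V m b
  crosses₂ (inj₁ (m<I , I<b , _))   = ℕ.<⇒≱ (ℕ.<-trans m<I I<b) b≤m
  crosses₂ (inj₂ (V<b , b≤I , I<m)) = absurd (ℕ.<⇒≤ (ℕ.<-≤-trans V<b b≤I)) I<m

  peaks₁ : Peaks m b I V ⇔ (i < m × v ≡ m)
  peaks₁ = mk⇔
    (λ (_ , I<m , V≡1+m) → PunchIn-<⁻ p I<m , ℕ.suc-injective (≡.trans (≡.sym (PunchIn-above q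
         (PunchIn->⁻ q (ℕ.≤-trans (s≤s b≤m) (ℕ.≤-reflexive (≡.sym V≡1+m)))))) V≡1+m))
    (λ { (i<m , ≡.refl) → b≤m , PunchIn-<⁺ p i<m , PunchIn-above q b≤m })

  peaks₂ : ¬ Peaks I V m b
  peaks₂ (_ , m<I , ≡.refl) = ℕ.<⇒≱ (ℕ.<-trans m<I (ℕ.n<1+n I)) b≤m

-- The new point is the excedance (a, m + 1), and the m other open positions have values beyond m +
-- 1 after the insertion. Those before a enclose it, the others cross it: the same counts as for a
-- non-excedance, with positions in place of values.
module ExcedanceEdges {m a i v I V : ℕ} (a≤m : a ≤ m)
         (p : PunchIn a i I) (q : PunchIn (suc m) v V) (h : i < m → m < v) where

  private
    absurd : V ≤ m → ¬ (i < m)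
    absurd V≤m i<m = ℕ.<⇒≱ (h i<m) (ℕ.≤-trans (PunchIn-increasing q) V≤m)
    I≤m⇒ : a < I → I ≤ m → i < m
    I≤m⇒ a<I I≤m = subst (_≤ m) (PunchIn-above p (PunchIn->⁻ p a<I)) I≤m
    I<a⇒ : I < a → i < m
    I<a⇒ I<a = ℕ.<-≤-trans (PunchIn-<⁻ p I<a) a≤m

  nests₁ : Nests a (suc m) I V ⇔ i < a
  nests₁ = mk⇔
    (λ { (inj₁ (I<a , _)) → PunchIn-<⁻ p I<a
       ; (inj₂ (_ , m<a , _)) → contradiction a≤m (ℕ.<⇒≱ m<a) })
    (λ i<a → inj₁ (PunchIn-<⁺ p i<a , s≤s a≤m , PunchIn->⁺ q (h (ℕ.<-≤-trans i<a a≤m))))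

  nests₂ : ¬ Nests I V a (suc m)
  nests₂ (inj₁ (a<I , I<V , V≤m)) = absurd (s≤s⁻¹ V≤m) (I≤m⇒ a<I (ℕ.<⇒≤ (ℕ.<-≤-trans I<V (s≤s⁻¹ V≤m))))
  nests₂ (inj₂ (_ , V≤I , I<a))   = absurd (ℕ.≤-trans V≤I (ℕ.<⇒≤ (ℕ.<-≤-trans I<a a≤m))) (I<a⇒ I<a)

  crosses₁ : ¬ Crosses a (suc m) I V
  crosses₁ (inj₁ (I<a , _ , V≤m)) = absurd (s≤s⁻¹ V≤m) (I<a⇒ I<a)
  crosses₁ (inj₂ (m<V , V≤a , _)) = ℕ.<⇒≱ (ℕ.<-≤-trans m<V V≤a) (ℕ.m≤n⇒m≤1+n a≤m)

  crosses₂ : Crosses I V a (suc m) ⇔ (a ≤ i × i < m)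
  crosses₂ = mk⇔
    (λ { (inj₁ (a<I , I≤m , _)) → PunchIn->⁻ p a<I , I≤m⇒ a<I (s≤s⁻¹ I≤m)
       ; (inj₂ (_ , m<I , I<a)) → contradiction a≤m (ℕ.<⇒≱ (ℕ.<-trans m<I I<a)) })
    (λ (a≤i , i<m) → inj₁ (PunchIn->⁺ p a≤i , s≤s (subst (_≤ m) (≡.sym (PunchIn-above p a≤i)) i<m) ,
                            PunchIn->⁺ q (h i<m)))

  peaks₁ : ¬ Peaks a (suc m) I V
  peaks₁ (m<a , _) = ℕ.<⇒≱ m<a a≤m

  peaks₂ : ¬ Peaks I V a (suc m)
  -- The equation forces I = m. Since a < I, the old position is m - 1, which is open, so its value
  -- exceeds I.
  peaks₂ (V≤I , a<I , ≡.refl) = absurd V≤I (I≤m⇒ a<I ℕ.≤-refl)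

module InsertNonExcedance (a b : Fin (suc n)) (b≤a : toℕ b ≤ toℕ a)
                          (τ : Permutation′ n) (opens : Opens (toℕ a) (toℕ a) τ) where

  open Inserted a b ℕ.≤-refl b≤a ℕ.≤-refl (ℕ.m≤n⇒m≤1+n b≤a) τ opens
  private
    module E k = NonExcedanceEdges b≤a (posV k) (valV k) (opens k)
    m = toℕ a

  nests-insert : pairs nests? (insert a b τ) ≡ smaller n (toℕ b) ℕ.+ pairs nests? τ
  nests-insert = ≡.trans
    (pairs-insert nests? a b τ ¬Nests-self
      (λ k → edge-first (nests? _ _ _ _) (nests? _ _ _ _) (_ ℕ.<? _) (E.nests₁ k) (E.nests₂ k)) nests-inner)
    (cong (ℕ._+ pairs nests? τ) (count-permute (λ k → toℕ k ℕ.<? toℕ b) τ))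

  crosses-insert : pairs crosses? (insert a b τ) ≡ between n (toℕ b) m ℕ.+ pairs crosses? τ
  crosses-insert = ≡.trans
    (pairs-insert crosses? a b τ ¬Crosses-self
      (λ k → edge-first (crosses? _ _ _ _) (crosses? _ _ _ _) (_ ℕ.≤? _ ×-dec _ ℕ.<? _) (E.crosses₁ k) (E.crosses₂ k)) crosses-inner)
    (cong (ℕ._+ pairs crosses? τ) (count-permute (λ k → toℕ b ℕ.≤? toℕ k ×-dec toℕ k ℕ.<? m) τ))

  peaks-insert : pairs peaks? (insert a b τ) ≡ count (closes? m τ) ℕ.+ pairs peaks? τ
  peaks-insert = pairs-insert peaks? a b τ ¬Peaks-self
    (λ k → edge-first (peaks? _ _ _ _) (peaks? _ _ _ _) (closes? m τ k) (E.peaks₁ k) (E.peaks₂ k)) peaks-inner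

  excs-inserted : excs (insert a b τ) ≡ excs τ
  excs-inserted = ≡.trans (excs-insert a b τ excs-inner)
    (cong (ℕ._+ excs τ) (ι-false (_ ℕ.<? _) (ℕ.≤⇒≯ b≤a)))

module InsertExcedance (a b : Fin (suc n)) {m : ℕ} (a≤m : toℕ a ≤ m) (b≡1+m : toℕ b ≡ suc m)
                       (τ : Permutation′ n) (opens : Opens m (suc m) τ) where

  open Inserted a b a≤m (ℕ.≤-reflexive b≡1+m) (ℕ.n≤1+n m) (ℕ.≤-reflexive b≡1+m) τ opens
  private
    valV′ : ∀ k → PunchIn (suc m) (toℕ (τ ⟨$⟩ʳ k)) (toℕ (punchIn b (τ ⟨$⟩ʳ k)))
    valV′ k = subst (λ c → PunchIn c (toℕ (τ ⟨$⟩ʳ k)) (toℕ (punchIn b (τ ⟨$⟩ʳ k)))) b≡1+m (valV k)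
    module E k = ExcedanceEdges a≤m (posV k) (valV′ k) (opens k)

    -- `pairs-insert` with `suc m` written for `toℕ b`, the form in which `ExcedanceEdges` describes
    -- the new point.
    pairs-insert′ : ∀ {ρ} (ρ? : PointDec ρ) {g : Fin n → ℕ} →
      ¬ ρ (toℕ a) (suc m) (toℕ a) (suc m) →
      (∀ k → ι (ρ? (toℕ a) (suc m) (toℕ (punchIn a k)) (toℕ (punchIn b (τ ⟨$⟩ʳ k))))
           ℕ.+ ι (ρ? (toℕ (punchIn a k)) (toℕ (punchIn b (τ ⟨$⟩ʳ k))) (toℕ a) (suc m)) ≡ g k) →
      (∀ k l → ρ (toℕ k) (toℕ (τ ⟨$⟩ʳ k)) (toℕ l) (toℕ (τ ⟨$⟩ʳ l))
             ⇔ ρ (toℕ (punchIn a k)) (toℕ (punchIn b (τ ⟨$⟩ʳ k))) (toℕ (punchIn a l)) (toℕ (punchIn b (τ ⟨$⟩ʳ l)))) →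
      pairs ρ? (insert a b τ) ≡ sum g ℕ.+ pairs ρ? τ
    pairs-insert′ {ρ} ρ? {g} with e ← pairs-insert ρ? a b τ {g} rewrite b≡1+m = e

  nests-insert : pairs nests? (insert a b τ) ≡ smaller n (toℕ a) ℕ.+ pairs nests? τ
  nests-insert = pairs-insert′ nests? ¬Nests-self
    (λ k → edge-first (nests? _ _ _ _) (nests? _ _ _ _) (_ ℕ.<? _) (E.nests₁ k) (E.nests₂ k)) nests-inner

  crosses-insert : pairs crosses? (insert a b τ) ≡ between n (toℕ a) m ℕ.+ pairs crosses? τ
  crosses-insert = pairs-insert′ crosses? ¬Crosses-self
    (λ k → edge-second (crosses? _ _ _ _) (crosses? _ _ _ _) (_ ℕ.≤? _ ×-dec _ ℕ.<? _) (E.crosses₁ k) (E.crosses₂ k)) crosses-inner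

  peaks-insert : pairs peaks? (insert a b τ) ≡ pairs peaks? τ
  peaks-insert = ≡.trans
    (pairs-insert′ peaks? ¬Peaks-self
      (λ k → edge-none (peaks? _ _ _ _) (peaks? _ _ _ _) (E.peaks₁ k) (E.peaks₂ k)) peaks-inner)
    (cong (ℕ._+ pairs peaks? τ) (sum-zero {n} λ _ → ≡.refl))

  excs-inserted : excs (insert a b τ) ≡ suc (excs τ)
  excs-inserted = ≡.trans (excs-insert a b τ excs-inner)
    (cong (ℕ._+ excs τ) (ι-true (_ ℕ.<? _) (ℕ.≤-trans (s≤s a≤m) (ℕ.≤-reflexive (≡.sym b≡1+m)))))

-- Splitting a permutation into one point and the rest

_≈?_ : ∀ {n} (σ τ : Permutation′ n) → Dec (σ Perm.≈ τ)
σ ≈? τ = Fin.all? λ i → σ ⟨$⟩ʳ i Fin.≟ τ ⟨$⟩ʳ i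

punched : ∀ {n} (a k : Fin (suc n)) → a ≡ k ⊎ ∃ λ l → k ≡ punchIn a l
punched a k with a Fin.≟ k
... | yes a≡k = inj₁ a≡k
... | no  a≢k = inj₂ (punchOut a≢k , ≡.sym (Fin.punchIn-punchOut a≢k))

-- A permutation determines the value at `a` and the pattern of the rest. This makes any position
-- available for decomposing `𝔖`, which itself inserts at position zero.
≈-insert⇔ : ∀ {n} a b (σ : Permutation′ (suc n)) (τ : Permutation′ n) →
            σ Perm.≈ insert a b τ ⇔ (σ ⟨$⟩ʳ a ≡ b × remove a σ Perm.≈ τ)
≈-insert⇔ a b σ τ = mk⇔ ⇒ ⇐
  where
  ⇒ : σ Perm.≈ insert a b τ → σ ⟨$⟩ʳ a ≡ b × remove a σ Perm.≈ τ
  ⇒ eq = σa≡b , λ k → Fin.punchIn-injective b _ _ (≡.trans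
      (cong (λ c → punchIn c (remove a σ ⟨$⟩ʳ k)) (≡.sym σa≡b))
      (≡.trans (≡.sym (punchIn-permute σ a k)) (≡.trans (eq (punchIn a k)) (insert-punchIn a b τ k))))
    where
    σa≡b : σ ⟨$⟩ʳ a ≡ b
    σa≡b = ≡.trans (eq a) (insert-self a b τ)
  ⇐ : σ ⟨$⟩ʳ a ≡ b × remove a σ Perm.≈ τ → σ Perm.≈ insert a b τ
  ⇐ (≡.refl , eq) k with punched a k
  ... | inj₁ ≡.refl       = ≡.sym (insert-self a b τ)
  ... | inj₂ (l , ≡.refl) = ≡.trans (punchIn-permute σ a l)
                              (≡.trans (cong (punchIn b) (eq l)) (≡.sym (insert-punchIn a b τ l)))

-- The counterpart with the value fixed; the deleted position is then its preimage.
≈-insert⇔ˡ : ∀ {n} a b (σ : Permutation′ (suc n)) (τ : Permutation′ n) →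
             σ Perm.≈ insert a b τ ⇔ (σ ⟨$⟩ˡ b ≡ a × remove (σ ⟨$⟩ˡ b) σ Perm.≈ τ)
≈-insert⇔ˡ a b σ τ = mk⇔ ⇒ ⇐
  where
  ⇒ : σ Perm.≈ insert a b τ → σ ⟨$⟩ˡ b ≡ a × remove (σ ⟨$⟩ˡ b) σ Perm.≈ τ
  ⇒ eq with ≡.refl , eq′ ← to (≈-insert⇔ a b σ τ) eq =
    Perm.inverseˡ σ , subst (λ c → remove c σ Perm.≈ τ) (≡.sym (Perm.inverseˡ σ)) eq′
  ⇐ : σ ⟨$⟩ˡ b ≡ a × remove (σ ⟨$⟩ˡ b) σ Perm.≈ τ → σ Perm.≈ insert a b τ
  ⇐ (≡.refl , eq) = from (≈-insert⇔ a b σ τ) (Perm.inverseʳ σ , eq)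

-- The alternatives when a position or a value is read

opens? : ∀ {n} m θ (σ : Permutation′ n) → Dec (Opens m θ σ)
opens? m θ σ = Fin.all? λ k → toℕ k ℕ.<? m →-dec θ ℕ.≤? toℕ (σ ⟨$⟩ʳ k)

module _ {n : ℕ} where

  Opens-resp : ∀ {m θ} {σ τ : Permutation′ n} → σ Perm.≈ τ → Opens m θ σ → Opens m θ τ
  Opens-resp {θ = θ} σ≈τ opens k k<m = subst (λ v → θ ≤ toℕ v) (σ≈τ k) (opens k k<m)

  NonExcedanceAt : Fin n → Permutation′ n → Set
  NonExcedanceAt a σ = Opens (toℕ a) (suc (toℕ a)) σ × toℕ (σ ⟨$⟩ʳ a) ≤ toℕ a

  nonExcedanceAt? : ∀ a σ → Dec (NonExcedanceAt a σ)
  nonExcedanceAt? a σ = opens? (toℕ a) (suc (toℕ a)) σ ×-dec toℕ (σ ⟨$⟩ʳ a) ℕ.≤? toℕ a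

  NonExcedanceAt-resp : ∀ {a σ τ} → σ Perm.≈ τ → NonExcedanceAt a σ → NonExcedanceAt a τ
  NonExcedanceAt-resp {a} {σ} {τ} σ≈τ (opens , σa≤a) =
    Opens-resp {σ = σ} {τ} σ≈τ opens , subst (λ v → toℕ v ≤ toℕ a) (σ≈τ a) σa≤a

  Closed : ℕ → Permutation′ n → Set
  Closed m σ = ∃ λ k → toℕ k < m × toℕ (σ ⟨$⟩ʳ k) ≡ m

  closed? : ∀ m σ → Dec (Closed m σ)
  closed? m σ = Fin.any? (closes? m σ)

  ExcedanceTo : ℕ → Permutation′ n → Set
  ExcedanceTo m σ = Opens m m σ × Closed m σ

  excedanceTo? : ∀ m σ → Dec (ExcedanceTo m σ)
  excedanceTo? m σ = opens? m m σ ×-dec closed? m σ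

  ExcedanceTo-resp : ∀ {m σ τ} → σ Perm.≈ τ → ExcedanceTo m σ → ExcedanceTo m τ
  ExcedanceTo-resp {m} {σ} {τ} σ≈τ (opens , k , k<m , σk≡m) =
    Opens-resp {σ = σ} {τ} σ≈τ opens , k , k<m , ≡.trans (cong toℕ (≡.sym (σ≈τ k))) σk≡m

  count-closes : ∀ m (σ : Permutation′ n) → count (closes? m σ) ≡ ι (closed? m σ)
  count-closes m σ = count-unique (closes? m σ)
    λ (_ , p) (_ , q) → ⟨$⟩ʳ-injective σ (≡.trans p (≡.sym q))

  -- A position that is read and is not a non-excedance becomes a further open position.
  -- `NonExcedanceAt` is the other alternative.
  opens-suc⇔ : ∀ a (σ : Permutation′ n) →
    Opens (suc (toℕ a)) (suc (toℕ a)) σ ⇔ (Opens (toℕ a) (suc (toℕ a)) σ × ¬ (toℕ (σ ⟨$⟩ʳ a) ≤ toℕ a))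
  opens-suc⇔ a σ = mk⇔
    (λ opens → (λ k k<a → opens k (ℕ.m<n⇒m<1+n k<a)) , ℕ.<⇒≱ (opens a ℕ.≤-refl))
    (λ (opens , a<σa) k k≤a → [ opens k , (λ k≡a → subst (λ k → toℕ a < toℕ (σ ⟨$⟩ʳ k))
        (Fin.toℕ-injective (≡.sym k≡a)) (ℕ.≰⇒> a<σa)) ] (ℕ.m<1+n⇒m<n∨m≡n k≤a))

  -- If no open position takes the value m just read, the bound on the values of open positions
  -- rises to m + 1. `ExcedanceTo` is the other alternative.
  opens-strict⇔ : ∀ m (σ : Permutation′ n) → Opens m (suc m) σ ⇔ (Opens m m σ × ¬ Closed m σ)
  opens-strict⇔ m σ = mk⇔
    (λ opens → (λ k k<m → ℕ.<⇒≤ (opens k k<m)) ,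
               (λ (k , k<m , σk≡m) → ℕ.<⇒≢ (opens k k<m) (≡.sym σk≡m)))
    (λ (opens , ¬closed) k k<m → ℕ.≤∧≢⇒< (opens k k<m) (λ m≡σk → ¬closed (k , k<m , ≡.sym m≡σk)))

-- Open positions precede `a` and keep their index. Their values exceed b, so deleting b lowers each
-- by one, and the bound drops from m + 1 to m.
nonExcedanceAt-insert⇔ : ∀ (a b : Fin (suc n)) (τ : Permutation′ n) →
  NonExcedanceAt a (insert a b τ) ⇔ (toℕ b ≤ toℕ a × Opens (toℕ a) (toℕ a) τ)
nonExcedanceAt-insert⇔ a b τ = mk⇔ ⇒ ⇐
  where
  σ = insert a b τ
  m = toℕ a
  ⇒ : NonExcedanceAt a σ → toℕ b ≤ m × Opens m m τ
  ⇒ (opens , σa≤a) = subst (λ v → toℕ v ≤ m) (insert-self a b τ) σa≤a , λ k k<m →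
    s≤s⁻¹ (ℕ.≤-trans (opens (punchIn a k) (PunchIn-<⁺ (punchIn-view a k) k<m))
      (ℕ.≤-trans (ℕ.≤-reflexive (cong toℕ (insert-punchIn a b τ k))) (PunchIn-≤suc (punchIn-view b (τ ⟨$⟩ʳ k)))))
  ⇐ : toℕ b ≤ m × Opens m m τ → NonExcedanceAt a σ
  ⇐ (b≤m , opens) = opens′ , subst (λ v → toℕ v ≤ m) (≡.sym (insert-self a b τ)) b≤m
    where
    opens′ : Opens m (suc m) σ
    opens′ k k<m with punched a k
    ... | inj₁ ≡.refl = contradiction k<m (ℕ.<-irrefl ≡.refl)
    ... | inj₂ (l , ≡.refl) = subst (m <_)
        (≡.sym (≡.trans (cong toℕ (insert-punchIn a b τ l)) (PunchIn-above (punchIn-view b _) (ℕ.≤-trans b≤m m≤τl))))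
        (s≤s m≤τl)
      where
      m≤τl : m ≤ toℕ (τ ⟨$⟩ʳ l)
      m≤τl = opens l (PunchIn-<⁻ (punchIn-view a l) k<m)

-- By injectivity the open position with value m + 1 is `a` itself. The m other open positions have
-- larger values, which the deletion lowers to at least m + 1.
excedanceTo-insert⇔ : ∀ (a b : Fin (suc n)) (τ : Permutation′ n) {m} → toℕ b ≡ suc m →
  ExcedanceTo (suc m) (insert a b τ) ⇔ (toℕ a ≤ m × Opens m (suc m) τ)
excedanceTo-insert⇔ a b τ {m} b≡1+m = mk⇔ ⇒ ⇐
  where
  σ = insert a b τ
  valV : ∀ k → PunchIn (suc m) (toℕ (τ ⟨$⟩ʳ k)) (toℕ (σ ⟨$⟩ʳ punchIn a k))
  valV k = subst₂ (λ c V → PunchIn c (toℕ (τ ⟨$⟩ʳ k)) V)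
    b≡1+m (≡.sym (cong toℕ (insert-punchIn a b τ k))) (punchIn-view b (τ ⟨$⟩ʳ k))
  ⇒ : ExcedanceTo (suc m) σ → toℕ a ≤ m × Opens m (suc m) τ
  ⇒ (opens , k , k≤m , σk≡) = subst (λ k → toℕ k ≤ m) k≡a (s≤s⁻¹ k≤m) , opens′
    where
    k≡a : k ≡ a
    k≡a = ⟨$⟩ʳ-injective σ (≡.trans σk≡ (≡.sym (≡.trans (cong toℕ (insert-self a b τ)) b≡1+m)))
    opens′ : Opens m (suc m) τ
    opens′ l l<m with toℕ (σ ⟨$⟩ʳ punchIn a l) | valV l
                    | opens (punchIn a l) (ℕ.≤-<-trans (PunchIn-≤suc (punchIn-view a l)) (s≤s l<m))
    ... | _ | below v<1+m | 1+m≤v = contradiction v<1+m (ℕ.≤⇒≯ 1+m≤v)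
    ... | _ | above 1+m≤v | _     = 1+m≤v
  ⇐ : toℕ a ≤ m × Opens m (suc m) τ → ExcedanceTo (suc m) σ
  ⇐ (a≤m , opens) = opens′ , a , s≤s a≤m , σa≡
    where
    σa≡ : toℕ (σ ⟨$⟩ʳ a) ≡ suc m
    σa≡ = ≡.trans (cong toℕ (insert-self a b τ)) b≡1+m
    opens′ : Opens (suc m) (suc m) σ
    opens′ k k≤m with punched a k
    ... | inj₁ ≡.refl       = ℕ.≤-reflexive (≡.sym σa≡)
    ... | inj₂ (l , ≡.refl) = ℕ.≤-trans (opens l (l<m (punchIn-view a l) k≤m)) (PunchIn-increasing (valV l))
      where
      l<m : ∀ {l L} → PunchIn (toℕ a) l L → L < suc m → l < m
      l<m (below l<a) _   = ℕ.<-≤-trans l<a a≤m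
      l<m (above _)   l<m = s≤s⁻¹ l<m

-- Sums over permutations

module Sums {c ℓ} (R : CommutativeRing c ℓ) where

  open CommutativeRing R hiding (zero)
  open import Relation.Binary.Reasoning.Setoid setoid
  open import Algebra.Properties.CommutativeSemigroup +-commutativeSemigroup using (interchange)
  open Polynomials R using (∑)

  Σ : ∀ {a} {X : Set a} → List X → (X → Carrier) → Carrier
  Σ xs f = ∑ (List.map f xs)

  module _ {a} {X : Set a} where

    Σ-cong : ∀ {f g : X → Carrier} → (∀ x → f x ≈ g x) → ∀ xs → Σ xs f ≈ Σ xs g
    Σ-cong f≈g []       = refl
    Σ-cong f≈g (x ∷ xs) = +-cong (f≈g x) (Σ-cong f≈g xs)

    Σ-zero : ∀ {f : X → Carrier} → (∀ x → f x ≈ 0#) → ∀ xs → Σ xs f ≈ 0#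
    Σ-zero f≈0 []       = refl
    Σ-zero f≈0 (x ∷ xs) = trans (+-cong (f≈0 x) (Σ-zero f≈0 xs)) (+-identityˡ 0#)

    Σ-+ : ∀ (f g : X → Carrier) xs → Σ xs (λ x → f x + g x) ≈ Σ xs f + Σ xs g
    Σ-+ f g []       = sym (+-identityˡ 0#)
    Σ-+ f g (x ∷ xs) = trans (+-congˡ (Σ-+ f g xs)) (interchange (f x) (g x) (Σ xs f) (Σ xs g))

    *-distribˡ-Σ : ∀ r (f : X → Carrier) xs → r * Σ xs f ≈ Σ xs (λ x → r * f x)
    *-distribˡ-Σ r f []       = zeroʳ r
    *-distribˡ-Σ r f (x ∷ xs) = trans (distribˡ r (f x) (Σ xs f)) (+-congˡ (*-distribˡ-Σ r f xs))

    *-distribʳ-Σ : ∀ r (f : X → Carrier) xs → Σ xs f * r ≈ Σ xs (λ x → f x * r)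
    *-distribʳ-Σ r f []       = zeroˡ r
    *-distribʳ-Σ r f (x ∷ xs) = trans (distribʳ r (f x) (Σ xs f)) (+-congˡ (*-distribʳ-Σ r f xs))

    Σ-++ : ∀ (f : X → Carrier) xs ys → Σ (xs ++ ys) f ≈ Σ xs f + Σ ys f
    Σ-++ f []       ys = sym (+-identityˡ _)
    Σ-++ f (x ∷ xs) ys = trans (+-congˡ (Σ-++ f xs ys)) (sym (+-assoc _ _ _))

    Σ-map : ∀ {b} {Y : Set b} (f : X → Carrier) (h : Y → X) ys → Σ (List.map h ys) f ≈ Σ ys (f ∘ h)
    Σ-map f h ys = reflexive (cong ∑ (≡.sym (List.map-∘ ys)))

  Σ-comm : ∀ {a b} {X : Set a} {Y : Set b} (f : X → Y → Carrier) xs ys →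
           Σ xs (λ x → Σ ys (f x)) ≈ Σ ys (λ y → Σ xs (λ x → f x y))
  Σ-comm f []       ys = sym (Σ-zero (λ _ → refl) ys)
  Σ-comm f (x ∷ xs) ys = trans (+-congˡ (Σ-comm f xs ys)) (sym (Σ-+ (f x) _ ys))

  Σ-cartesianProductWith : ∀ {a b d} {X : Set a} {Y : Set b} {Z : Set d} (f : Z → Carrier) (h : X → Y → Z) xs ys →
                           Σ (cartesianProductWith h xs ys) f ≈ Σ xs (λ x → Σ ys (λ y → f (h x y)))
  Σ-cartesianProductWith f h []       ys = refl
  Σ-cartesianProductWith f h (x ∷ xs) ys = trans
    (Σ-++ f (List.map (h x) ys) _)
    (+-cong (Σ-map f (h x) ys) (Σ-cartesianProductWith f h xs ys))

  δ : ∀ {a} {A : Set a} → Dec A → Carrier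
  δ A? = if does A? then 1# else 0#

  module _ {a} {A : Set a} where

    δ-cong : ∀ {b} {B : Set b} (A? : Dec A) (B? : Dec B) → A ⇔ B → δ A? ≈ δ B?
    δ-cong A? B? A⇔B = reflexive (cong (if_then 1# else 0#) (does-⇔ A⇔B A? B?))

    δ-true : (A? : Dec A) → A → δ A? ≈ 1#
    δ-true A? x = reflexive (cong (if_then 1# else 0#) (dec-true A? x))

    δ-false : (A? : Dec A) → ¬ A → δ A? ≈ 0#
    δ-false A? ¬x = reflexive (cong (if_then 1# else 0#) (dec-false A? ¬x))

    δ-× : ∀ {b} {B : Set b} (A? : Dec A) (B? : Dec B) → δ (A? ×-dec B?) ≈ δ A? * δ B?
    δ-× (yes _) B? = sym (*-identityˡ _)
    δ-× (no  _) B? = sym (zeroˡ _)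

    δ-*-cong : ∀ (A? : Dec A) {r s} → (A → r ≈ s) → δ A? * r ≈ δ A? * s
    δ-*-cong (yes x) r≈s = *-congˡ (r≈s x)
    δ-*-cong (no  _) r≈s = trans (zeroˡ _) (sym (zeroˡ _))

  -- Containing each class exactly once, in the weaker form that the indicators sum to 1 in the
  -- ring; this suffices for exchanging one list for another under a sum.
  Enumerates : ∀ {a r} {X : Set a} {_∼_ : X → X → Set r} → (∀ x y → Dec (x ∼ y)) → List X → Set _
  Enumerates _∼?_ xs = ∀ x → Σ xs (λ y → δ (x ∼? y)) ≈ 1#

  module _ {a r} {X : Set a} {_∼_ : X → X → Set r} (_∼?_ : ∀ x y → Dec (x ∼ y))
           (∼-sym : ∀ {x y} → x ∼ y → y ∼ x) where

    -- Double counting: expand each `f x` by the sum of δ (x ∼ y) over `ys`, exchange the sums, and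
    -- collapse the sum over `xs`.
    Σ-enumeration : ∀ xs ys → Enumerates _∼?_ xs → Enumerates _∼?_ ys →
                    ∀ {f} → (∀ x y → x ∼ y → f x ≈ f y) → Σ xs f ≈ Σ ys f
    Σ-enumeration xs ys enum-xs enum-ys {f} f-resp = begin
      Σ xs f                                        ≈⟨ Σ-cong (λ x → expand ys enum-ys x) xs ⟩
      Σ xs (λ x → Σ ys (λ y → δ (x ∼? y) * f x))    ≈⟨ Σ-comm (λ x y → δ (x ∼? y) * f x) xs ys ⟩
      Σ ys (λ y → Σ xs (λ x → δ (x ∼? y) * f x))    ≈⟨ Σ-cong (λ y → Σ-cong (λ x → swap x y) xs) ys ⟩
      Σ ys (λ y → Σ xs (λ x → δ (y ∼? x) * f y))    ≈⟨ Σ-cong (λ y → expand xs enum-xs y) ys ⟨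
      Σ ys f                                        ∎
      where
      expand : ∀ zs → Enumerates _∼?_ zs → ∀ x → f x ≈ Σ zs (λ z → δ (x ∼? z) * f x)
      expand zs enum x = begin
        f x                                ≈⟨ *-identityˡ (f x) ⟨
        1# * f x                           ≈⟨ *-congʳ (enum x) ⟨
        Σ zs (λ z → δ (x ∼? z)) * f x      ≈⟨ *-distribʳ-Σ (f x) _ zs ⟩
        Σ zs (λ z → δ (x ∼? z) * f x)      ∎
      swap : ∀ x y → δ (x ∼? y) * f x ≈ δ (y ∼? x) * f y
      swap x y = trans (δ-*-cong (x ∼? y) (f-resp x y)) (*-congʳ (δ-cong (x ∼? y) (y ∼? x) (mk⇔ ∼-sym ∼-sym)))

  allFin-enumerates : ∀ n → Enumerates Fin._≟_ (allFin n)
  allFin-enumerates (suc n) i = trans (+-congˡ tail) (head i)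
    where
    tail : Σ (List.tabulate suc) (λ j → δ (i Fin.≟ j)) ≈ Σ (allFin n) (λ j → δ (i Fin.≟ suc j))
    tail = trans (reflexive (cong (λ js → Σ js (λ j → δ (i Fin.≟ j))) (≡.sym (List.map-tabulate id suc))))
                 (Σ-map (λ j → δ (i Fin.≟ j)) suc (allFin n))
    head : ∀ i → δ (i Fin.≟ Fin.zero) + Σ (allFin n) (λ j → δ (i Fin.≟ suc j)) ≈ 1#
    head Fin.zero    = trans (+-congˡ (Σ-zero (λ _ → refl) (allFin n))) (+-identityʳ 1#)
    head (suc i) = trans (+-identityˡ _) (trans
      (Σ-cong (λ j → δ-cong (suc i Fin.≟ suc j) (i Fin.≟ j) (mk⇔ Fin.suc-injective (cong suc))) (allFin n))
      (allFin-enumerates n i))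

  -- By the equivalence, the indicator of σ ≈ h i τ is a product of an indicator in i and one in τ,
  -- so the inner sum is 1 times the former.
  insertions-enumerate : ∀ {n} (h : Fin (suc n) → Permutation′ n → Permutation′ (suc n))
    (f : Permutation′ (suc n) → Fin (suc n)) (g : Permutation′ (suc n) → Permutation′ n) →
    (∀ σ i τ → σ Perm.≈ h i τ ⇔ (f σ ≡ i × g σ Perm.≈ τ)) →
    ∀ L → Enumerates _≈?_ L → Enumerates _≈?_ (cartesianProductWith h (allFin (suc n)) L)
  insertions-enumerate {n} h f g h⇔ L enum σ = begin
    Σ (cartesianProductWith h (allFin (suc n)) L) (λ ρ → δ (σ ≈? ρ))
      ≈⟨ Σ-cartesianProductWith (λ ρ → δ (σ ≈? ρ)) h (allFin (suc n)) L ⟩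
    Σ (allFin (suc n)) (λ i → Σ L (λ τ → δ (σ ≈? h i τ)))
      ≈⟨ Σ-cong row (allFin (suc n)) ⟩
    Σ (allFin (suc n)) (λ i → δ (f σ Fin.≟ i))
      ≈⟨ allFin-enumerates (suc n) (f σ) ⟩
    1# ∎
    where
    row : ∀ i → Σ L (λ τ → δ (σ ≈? h i τ)) ≈ δ (f σ Fin.≟ i)
    row i = begin
      Σ L (λ τ → δ (σ ≈? h i τ))
        ≈⟨ Σ-cong (λ τ → trans (δ-cong (σ ≈? h i τ) (f σ Fin.≟ i ×-dec g σ ≈? τ) (h⇔ σ i τ))
                               (δ-× (f σ Fin.≟ i) (g σ ≈? τ))) L ⟩
      Σ L (λ τ → δ (f σ Fin.≟ i) * δ (g σ ≈? τ))   ≈⟨ *-distribˡ-Σ _ _ L ⟨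
      δ (f σ Fin.≟ i) * Σ L (λ τ → δ (g σ ≈? τ))   ≈⟨ *-congˡ (enum (g σ)) ⟩
      δ (f σ Fin.≟ i) * 1#                         ≈⟨ *-identityʳ _ ⟩
      δ (f σ Fin.≟ i)                              ∎

  𝔖-enumerates : ∀ n → Enumerates _≈?_ (𝔖 n)
  𝔖-enumerates zero    σ = +-identityʳ 1#
  𝔖-enumerates (suc n)   = insertions-enumerate (insert Fin.zero) (_⟨$⟩ʳ Fin.zero) (remove Fin.zero)
                             (λ σ j τ → ≈-insert⇔ Fin.zero j σ τ) (𝔖 n) (𝔖-enumerates n)

  module _ {n} {f : Permutation′ (suc n) → Carrier} (f-resp : ∀ σ τ → σ Perm.≈ τ → f σ ≈ f τ) where

    private
      Σ-𝔖 : ∀ L → Enumerates _≈?_ L → Σ (𝔖 (suc n)) f ≈ Σ L f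
      Σ-𝔖 L enum = Σ-enumeration _≈?_ (λ σ≈τ i → ≡.sym (σ≈τ i)) (𝔖 (suc n)) L (𝔖-enumerates (suc n)) enum f-resp

    -- Inserting at `a` instead of at zero lists the same permutations in another order, and `f`
    -- respects pointwise equality.
    Σ-𝔖-position : ∀ a → Σ (𝔖 (suc n)) f ≈ Σ (allFin (suc n)) (λ b → Σ (𝔖 n) (λ τ → f (insert a b τ)))
    Σ-𝔖-position a = trans
      (Σ-𝔖 (cartesianProductWith (insert a) (allFin (suc n)) (𝔖 n))
        (insertions-enumerate (insert a) (_⟨$⟩ʳ a) (remove a) (λ σ b τ → ≈-insert⇔ a b σ τ) (𝔖 n) (𝔖-enumerates n)))
      (Σ-cartesianProductWith f (insert a) (allFin (suc n)) (𝔖 n))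

    Σ-𝔖-value : ∀ b → Σ (𝔖 (suc n)) f ≈ Σ (allFin (suc n)) (λ a → Σ (𝔖 n) (λ τ → f (insert a b τ)))
    Σ-𝔖-value b = trans
      (Σ-𝔖 (cartesianProductWith (λ a → insert a b) (allFin (suc n)) (𝔖 n))
        (insertions-enumerate (λ a → insert a b) (_⟨$⟩ˡ b) (λ σ → remove (σ ⟨$⟩ˡ b) σ)
             (λ σ a τ → ≈-insert⇔ˡ a b σ τ) (𝔖 n) (𝔖-enumerates n)))
      (Σ-cartesianProductWith f (λ a → insert a b) (allFin (suc n)) (𝔖 n))

-- The Motzkin recurrence

module Transfer {c ℓ} (R : CommutativeRing c ℓ) (p q : CommutativeRing.Carrier R) where

  open CommutativeRing R hiding (zero)
  open import Relation.Binary.Reasoning.Setoid setoid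
  open import Algebra.Properties.CommutativeSemigroup *-commutativeSemigroup
    using (interchange)
  open import Algebra.Properties.Semiring.Exp semiring using (_^_; ^-homo-*; ^-congʳ)
  open import Algebra.Solver.Ring.NaturalCoefficients.Default commutativeSemiring
  open Sums R

  -- The bracketing and the final factor 1 are those to which the product in `P` unfolds.
  weight : Carrier → Carrier → ∀ {n} → Permutation′ n → Carrier
  weight x t σ = p ^ pairs nests? σ * (q ^ pairs crosses? σ * (x ^ pairs peaks? σ * (t ^ excs σ * 1#)))

  weight-resp : ∀ {x t n} {σ τ : Permutation′ n} → σ Perm.≈ τ → weight x t σ ≈ weight x t τ
  weight-resp {x} {t} {σ = σ} {τ} σ≈τ =
    *-cong (^-congʳ p (pairs-cong nests? {σ = σ} {τ} σ≈τ)) (*-cong (^-congʳ q (pairs-cong crosses? {σ = σ} {τ} σ≈τ))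
      (*-cong (^-congʳ x (pairs-cong peaks? {σ = σ} {τ} σ≈τ)) (*-congʳ (^-congʳ t (excs-cong σ τ σ≈τ)))))
    where
    excs-cong : ∀ {n} (σ τ : Permutation′ n) → σ Perm.≈ τ → excs σ ≡ excs τ
    excs-cong σ τ σ≈τ = sum-cong λ k → cong (λ v → ι (toℕ k ℕ.<? toℕ v)) (σ≈τ k)

  -- strict x t m n enumerates what is left by a scan about to read position m, and weak x t y m n
  -- what is left by a scan about to read value m; y marks the case that this value closes an
  -- open position (it is x if the position just read was closed by a non-excedance, so
  -- that a peak arises, and 1 otherwise).
  strict : (x t : Carrier) (m n : ℕ) → Carrier
  strict x t m n = Σ (𝔖 n) λ σ → δ (opens? m (suc m) σ) * weight x t σ

  weak : (x t y : Carrier) (m n : ℕ) → Carrier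
  weak x t y m n = Σ (𝔖 n) λ σ → δ (opens? m m σ) * (y ^ count (closes? m σ) * weight x t σ)

  edgeWeight : (n b m : ℕ) → Carrier
  edgeWeight n b m = p ^ smaller n b * q ^ between n b m

  -- For m ≤ n this is the (p, q)-analogue of m + 1, the sum of p^b q^(m - b) over b ≤ m.
  stepWeight : (n m : ℕ) → Carrier
  stepWeight n m = Σ (allFin (suc n)) λ b → δ (toℕ b ℕ.≤? m) * edgeWeight n (toℕ b) m

  1^n≈1 : ∀ n → 1# ^ n ≈ 1#
  1^n≈1 zero    = refl
  1^n≈1 (suc n) = trans (*-identityˡ _) (1^n≈1 n)

  weight-insert : ∀ {x t x′ t′ n} b m {c e} (σ : Permutation′ (suc n)) (τ : Permutation′ n) →
    pairs nests? σ ≡ smaller n b ℕ.+ pairs nests? τ →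
    pairs crosses? σ ≡ between n b m ℕ.+ pairs crosses? τ →
    pairs peaks? σ ≡ c ℕ.+ pairs peaks? τ →
    excs σ ≡ e ℕ.+ excs τ →
    x ^ c ≈ x′ → t ^ e ≈ t′ →
    weight x t σ ≈ edgeWeight n b m * (x′ * (t′ * weight x t τ))
  weight-insert {x} {t} {x′} {t′} {n} b m {c} {e} σ τ ns cs ps es xc te = begin
    weight x t σ
      ≈⟨ *-cong (pow p (smaller n b) (pairs nests? τ) ns)
           (*-cong (pow q (between n b m) (pairs crosses? τ) cs)
             (*-cong (pow x c (pairs peaks? τ) ps) (*-congʳ (pow t e (excs τ) es)))) ⟩
    (P₁ * P₂) * ((Q₁ * Q₂) * ((x ^ c * X₂) * ((t ^ e * T₂) * 1#)))
      ≈⟨ *-congˡ (*-congˡ (*-cong (*-congʳ xc) (*-congʳ (*-congʳ te)))) ⟩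
    (P₁ * P₂) * ((Q₁ * Q₂) * ((x′ * X₂) * ((t′ * T₂) * 1#)))
      ≈⟨ solve 8 (λ P₁ P₂ Q₁ Q₂ X₁ X₂ T₁ T₂ →
           (P₁ :* P₂) :* ((Q₁ :* Q₂) :* ((X₁ :* X₂) :* ((T₁ :* T₂) :* con 1)))
             := (P₁ :* Q₁) :* (X₁ :* (T₁ :* (P₂ :* (Q₂ :* (X₂ :* (T₂ :* con 1)))))))
           refl P₁ P₂ Q₁ Q₂ x′ X₂ t′ T₂ ⟩
    edgeWeight n b m * (x′ * (t′ * weight x t τ)) ∎
    where
    P₁ = p ^ smaller n b
    P₂ = p ^ pairs nests? τ
    Q₁ = q ^ between n b m
    Q₂ = q ^ pairs crosses? τ
    X₂ = x ^ pairs peaks? τ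
    T₂ = t ^ excs τ
    pow : ∀ y {i} j k → i ≡ j ℕ.+ k → y ^ i ≈ y ^ j * y ^ k
    pow y j k i≡ = trans (^-congʳ y i≡) (^-homo-* y j k)

  -- Splits a restricted sum by a further condition B, with the summand rewritten differently
  -- according to whether B holds.
  δ-split : ∀ {ℓ₁ ℓ₂ ℓ₃ ℓ₄} {A : Set ℓ₁} {B : Set ℓ₂} {A₁ : Set ℓ₃} {A₂ : Set ℓ₄}
    (A? : Dec A) (B? : Dec B) (A₁? : Dec A₁) (A₂? : Dec A₂) →
    A₁ ⇔ (A × B) → A₂ ⇔ (A × ¬ B) → ∀ {r r₁ r₂} → (B → r ≈ r₁) → (¬ B → r ≈ r₂) →
    δ A? * r ≈ δ A₁? * r₁ + δ A₂? * r₂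
  δ-split A? (yes b) A₁? A₂? A₁⇔ A₂⇔ eq₁ eq₂ = sym (begin
    δ A₁? * _ + δ A₂? * _
      ≈⟨ +-cong (*-cong (δ-cong A₁? A? (mk⇔ (proj₁ ∘ to A₁⇔) (λ a → from A₁⇔ (a , b)))) (sym (eq₁ b)))
                (*-congʳ (δ-false A₂? λ a₂ → proj₂ (to A₂⇔ a₂) b)) ⟩
    δ A? * _ + 0# * _   ≈⟨ +-congˡ (zeroˡ _) ⟩
    δ A? * _ + 0#       ≈⟨ +-identityʳ _ ⟩
    δ A? * _            ∎)
  δ-split A? (no ¬b) A₁? A₂? A₁⇔ A₂⇔ eq₁ eq₂ = sym (begin
    δ A₁? * _ + δ A₂? * _
      ≈⟨ +-cong (*-congʳ (δ-false A₁? λ a₁ → ¬b (proj₂ (to A₁⇔ a₁))))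
                (*-cong (δ-cong A₂? A? (mk⇔ (proj₁ ∘ to A₂⇔) (λ a → from A₂⇔ (a , ¬b)))) (sym (eq₂ ¬b))) ⟩
    0# * _ + δ A? * _   ≈⟨ +-congʳ (zeroˡ _) ⟩
    0# + δ A? * _       ≈⟨ +-identityˡ _ ⟩
    δ A? * _            ∎)

  Σ-product : ∀ n m (w : ℕ → Carrier) (g : Permutation′ n → Carrier) →
    Σ (allFin (suc n)) (λ b → Σ (𝔖 n) (λ τ → (δ (toℕ b ℕ.≤? m) * w (toℕ b)) * g τ))
      ≈ Σ (allFin (suc n)) (λ b → δ (toℕ b ℕ.≤? m) * w (toℕ b)) * Σ (𝔖 n) g
  Σ-product n m w g = trans
    (Σ-cong (λ b → sym (*-distribˡ-Σ _ g (𝔖 n))) (allFin (suc n)))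
    (sym (*-distribʳ-Σ _ _ (allFin (suc n))))

  module _ {x t : Carrier} where

    -- Position m is either a non-excedance, deleted at the cost `stepWeight n m`, or it becomes
    -- open. In the first case the next value creates a peak if it closes an open position, hence y
    -- = x; in the second it creates none, hence y = 1.
    strict-step : ∀ {n} (a : Fin (suc n)) → let m = toℕ a in
      strict x t m (suc n) ≈ stepWeight n m * weak x t x m n + weak x t 1# (suc m) (suc n)
    strict-step {n} a = begin
      strict x t m (suc n)
        ≈⟨ Σ-cong (λ σ → δ-split (opens? m (suc m) σ) (toℕ (σ ⟨$⟩ʳ a) ℕ.≤? m)
              (nonExcedanceAt? a σ) (opens? (suc m) (suc m) σ) (⇔-id _) (opens-suc⇔ a σ)
              (λ _ → refl) (λ _ → sym (trans (*-congʳ (1^n≈1 (count (closes? (suc m) σ)))) (*-identityˡ _)))) (𝔖 (suc n)) ⟩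
      Σ (𝔖 (suc n)) (λ σ → δ (nonExcedanceAt? a σ) * weight x t σ + _)
        ≈⟨ Σ-+ _ _ (𝔖 (suc n)) ⟩
      Σ (𝔖 (suc n)) (λ σ → δ (nonExcedanceAt? a σ) * weight x t σ) + weak x t 1# (suc m) (suc n)
        ≈⟨ +-congʳ removal ⟩
      stepWeight n m * weak x t x m n + weak x t 1# (suc m) (suc n) ∎
      where
      m = toℕ a
      inserted : ∀ b τ → δ (nonExcedanceAt? a (insert a b τ)) * weight x t (insert a b τ)
        ≈ (δ (toℕ b ℕ.≤? m) * edgeWeight n (toℕ b) m) * (δ (opens? m m τ) * (x ^ count (closes? m τ) * weight x t τ))
      inserted b τ = begin
        δ (nonExcedanceAt? a (insert a b τ)) * weight x t (insert a b τ)
          ≈⟨ *-congʳ (δ-cong (nonExcedanceAt? a (insert a b τ)) cond? (nonExcedanceAt-insert⇔ a b τ)) ⟩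
        δ cond? * weight x t (insert a b τ)
          ≈⟨ δ-*-cong cond? (λ (b≤a , opens) → let open InsertNonExcedance a b b≤a τ opens in
               weight-insert (toℕ b) m (insert a b τ) τ nests-insert crosses-insert peaks-insert excs-inserted refl refl) ⟩
        δ cond? * (edgeWeight n (toℕ b) m * (x ^ count (closes? m τ) * (1# * weight x t τ)))
          ≈⟨ *-cong (δ-× (toℕ b ℕ.≤? m) (opens? m m τ)) (*-congˡ (*-congˡ (*-identityˡ _))) ⟩
        (δ (toℕ b ℕ.≤? m) * δ (opens? m m τ)) * (edgeWeight n (toℕ b) m * (x ^ count (closes? m τ) * weight x t τ))
          ≈⟨ interchange _ _ _ _ ⟩
        (δ (toℕ b ℕ.≤? m) * edgeWeight n (toℕ b) m) * (δ (opens? m m τ) * (x ^ count (closes? m τ) * weight x t τ)) ∎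
        where cond? = toℕ b ℕ.≤? m ×-dec opens? m m τ
      removal : Σ (𝔖 (suc n)) (λ σ → δ (nonExcedanceAt? a σ) * weight x t σ) ≈ stepWeight n m * weak x t x m n
      removal = begin
        Σ (𝔖 (suc n)) (λ σ → δ (nonExcedanceAt? a σ) * weight x t σ)
          ≈⟨ Σ-𝔖-position (λ σ τ σ≈τ → *-cong
               (δ-cong (nonExcedanceAt? a σ) (nonExcedanceAt? a τ)
                 (mk⇔ (NonExcedanceAt-resp {σ = σ} {τ} σ≈τ) (NonExcedanceAt-resp {σ = τ} {σ} (λ k → ≡.sym (σ≈τ k)))))
               (weight-resp {σ = σ} {τ} σ≈τ)) a ⟩
        _ ≈⟨ Σ-cong (λ b → Σ-cong (inserted b) (𝔖 n)) (allFin (suc n)) ⟩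
        _ ≈⟨ Σ-product n m (λ b → edgeWeight n b m) _ ⟩
        stepWeight n m * weak x t x m n ∎

    -- The value m + 1 either closes an open position, and this excedance is deleted, or is left for
    -- a later non-excedance. The choice of the position a ≤ m gives the same `stepWeight` as the
    -- choice of a value in `strict-step`; the whole proof rests on this coincidence.
    weak-step : ∀ {n} (b : Fin (suc n)) {m} → toℕ b ≡ suc m → ∀ y →
      weak x t y (suc m) (suc n) ≈ (y * t) * (stepWeight n m * strict x t m n) + strict x t (suc m) (suc n)
    weak-step {n} b {m} b≡1+m y = begin
      weak x t y (suc m) (suc n)
        ≈⟨ Σ-cong (λ σ → δ-split (opens? (suc m) (suc m) σ) (closed? (suc m) σ)
              (excedanceTo? (suc m) σ) (opens? (suc m) (suc (suc m)) σ) (⇔-id _) (opens-strict⇔ (suc m) σ)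
              (λ closed → *-congʳ (trans (^-congʳ y (≡.trans (count-closes (suc m) σ) (ι-true (closed? (suc m) σ) closed))) (*-identityʳ y)))
              (λ ¬closed → trans (*-congʳ (^-congʳ y (≡.trans (count-closes (suc m) σ) (ι-false (closed? (suc m) σ) ¬closed))))
                                 (*-identityˡ _))) (𝔖 (suc n)) ⟩
      Σ (𝔖 (suc n)) (λ σ → δ (excedanceTo? (suc m) σ) * (y * weight x t σ) + _)
        ≈⟨ Σ-+ _ _ (𝔖 (suc n)) ⟩
      Σ (𝔖 (suc n)) (λ σ → δ (excedanceTo? (suc m) σ) * (y * weight x t σ)) + strict x t (suc m) (suc n)
        ≈⟨ +-congʳ removal ⟩
      (y * t) * (stepWeight n m * strict x t m n) + strict x t (suc m) (suc n) ∎
      where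
      inserted : ∀ a τ → δ (excedanceTo? (suc m) (insert a b τ)) * (y * weight x t (insert a b τ))
        ≈ (y * t) * ((δ (toℕ a ℕ.≤? m) * edgeWeight n (toℕ a) m) * (δ (opens? m (suc m) τ) * weight x t τ))
      inserted a τ = begin
        δ (excedanceTo? (suc m) (insert a b τ)) * (y * weight x t (insert a b τ))
          ≈⟨ *-congʳ (δ-cong (excedanceTo? (suc m) (insert a b τ)) cond? (excedanceTo-insert⇔ a b τ b≡1+m)) ⟩
        δ cond? * (y * weight x t (insert a b τ))
          ≈⟨ δ-*-cong cond? (λ (a≤m , opens) → let open InsertExcedance a b a≤m b≡1+m τ opens in
               *-congˡ (weight-insert (toℕ a) m (insert a b τ) τ nests-insert crosses-insert peaks-insert excs-inserted
                          refl (*-identityʳ t))) ⟩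
        δ cond? * (y * (edgeWeight n (toℕ a) m * (1# * (t * weight x t τ))))
          ≈⟨ *-congʳ (δ-× (toℕ a ℕ.≤? m) (opens? m (suc m) τ)) ⟩
        (δ (toℕ a ℕ.≤? m) * δ (opens? m (suc m) τ)) * (y * (edgeWeight n (toℕ a) m * (1# * (t * weight x t τ))))
          ≈⟨ solve 6 (λ d₁ d₂ y e t w → (d₁ :* d₂) :* (y :* (e :* (con 1 :* (t :* w))))
                        := (y :* t) :* ((d₁ :* e) :* (d₂ :* w))) refl _ _ _ _ _ _ ⟩
        (y * t) * ((δ (toℕ a ℕ.≤? m) * edgeWeight n (toℕ a) m) * (δ (opens? m (suc m) τ) * weight x t τ)) ∎
        where cond? = toℕ a ℕ.≤? m ×-dec opens? m (suc m) τ
      removal : Σ (𝔖 (suc n)) (λ σ → δ (excedanceTo? (suc m) σ) * (y * weight x t σ))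
                  ≈ (y * t) * (stepWeight n m * strict x t m n)
      removal = begin
        Σ (𝔖 (suc n)) (λ σ → δ (excedanceTo? (suc m) σ) * (y * weight x t σ))
          ≈⟨ Σ-𝔖-value (λ σ τ σ≈τ → *-cong
               (δ-cong (excedanceTo? (suc m) σ) (excedanceTo? (suc m) τ)
                 (mk⇔ (ExcedanceTo-resp {σ = σ} {τ} σ≈τ) (ExcedanceTo-resp {σ = τ} {σ} (λ k → ≡.sym (σ≈τ k)))))
               (*-congˡ (weight-resp {σ = σ} {τ} σ≈τ))) b ⟩
        _ ≈⟨ Σ-cong (λ a → trans (Σ-cong (inserted a) (𝔖 n)) (sym (*-distribˡ-Σ (y * t) _ (𝔖 n)))) (allFin (suc n)) ⟩
        _ ≈⟨ *-distribˡ-Σ (y * t) _ (allFin (suc n)) ⟨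
        _ ≈⟨ *-congˡ (Σ-product n m (λ a → edgeWeight n a m) _) ⟩
        (y * t) * (stepWeight n m * strict x t m n) ∎

    -- With no open position there is none to close, so y occurs with exponent 0, and both
    -- conditions on open positions are vacuous.
    weak-zero : ∀ {y} n → weak x t y 0 n ≈ strict x t 0 n
    weak-zero {y} n = Σ-cong (λ σ → *-cong
        (δ-cong (opens? 0 0 σ) (opens? 0 1 σ) (mk⇔ (λ _ k ()) (λ _ k ())))
        (trans (*-congʳ (^-congʳ y (sum-zero {n} λ _ → ≡.refl))) (*-identityˡ _))) (𝔖 n)

    -- The level steps are a non-excedance, and a position opened and closed at once. Both have
    -- weight w up to the factor t of the excedance, which gives 1 + t; at height 0 there is no down
    -- step.
    strict-zero-recurrence : ∀ n → strict x t 0 (suc (suc n))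
      ≈ (1# + t) * (stepWeight (suc n) 0 * strict x t 0 (suc n)) + strict x t 1 (suc (suc n))
    strict-zero-recurrence n = begin
      strict x t 0 (suc (suc n))
        ≈⟨ strict-step {suc n} zero ⟩
      w * weak x t x 0 (suc n) + weak x t 1# 1 (suc (suc n))
        ≈⟨ +-cong (*-congˡ (weak-zero (suc n))) (weak-step {suc n} (suc zero) ≡.refl 1#) ⟩
      w * s + ((1# * t) * (w * s) + r)
        ≈⟨ solve 4 (λ w s t r → w :* s :+ ((con 1 :* t) :* (w :* s) :+ r) := (con 1 :+ t) :* (w :* s) :+ r) refl w s t r ⟩
      (1# + t) * (w * s) + r ∎
      where
      w = stepWeight (suc n) 0
      s = strict x t 0 (suc n)
      r = strict x t 1 (suc (suc n))

    -- The first summand is the down step: a non-excedance whose next value closes an open position.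
    -- It removes two points and creates one peak and one excedance.
    strict-suc-recurrence : ∀ m n → suc m < suc n → strict x t (suc m) (suc (suc n))
      ≈ (x * t) * (stepWeight (suc n) (suc m) * (stepWeight n m * strict x t m n))
        + (1# + t) * (stepWeight (suc n) (suc m) * strict x t (suc m) (suc n)) + strict x t (suc (suc m)) (suc (suc n))
    strict-suc-recurrence m n m<n = begin
      strict x t (suc m) (suc (suc n))
        -- `strict-step` takes the height from an element of `Fin`, hence the passage through
        -- `fromℕ<`.
        ≡⟨ cong (λ m → strict x t m (suc (suc n))) (Fin.toℕ-fromℕ< (ℕ.m<n⇒m<1+n m<n)) ⟨
      strict x t (toℕ a) (suc (suc n))
        ≈⟨ strict-step a ⟩
      _ ≡⟨ cong (λ m → stepWeight (suc n) m * weak x t x m (suc n) + weak x t 1# (suc m) (suc (suc n))) (Fin.toℕ-fromℕ< (ℕ.m<n⇒m<1+n m<n)) ⟩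
      w * weak x t x (suc m) (suc n) + weak x t 1# (suc (suc m)) (suc (suc n))
        ≈⟨ +-cong (*-congˡ (weak-step (fromℕ< m<n) (Fin.toℕ-fromℕ< m<n) x))
                  (weak-step (fromℕ< (s≤s m<n)) (Fin.toℕ-fromℕ< (s≤s m<n)) 1#) ⟩
      w * ((x * t) * (w′ * f) + s) + ((1# * t) * (w * s) + r)
        ≈⟨ solve 7 (λ w w′ x t f s r → w :* ((x :* t) :* (w′ :* f) :+ s) :+ ((con 1 :* t) :* (w :* s) :+ r)
             := (x :* t) :* (w :* (w′ :* f)) :+ (con 1 :+ t) :* (w :* s) :+ r) refl w w′ x t f s r ⟩
      (x * t) * (w * (w′ * f)) + (1# + t) * (w * s) + r ∎
      where
      a = fromℕ< (ℕ.m<n⇒m<1+n m<n)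
      w = stepWeight (suc n) (suc m)
      w′ = stepWeight n m
      f = strict x t m n
      s = strict x t (suc m) (suc n)
      r = strict x t (suc (suc m)) (suc (suc n))

    -- An open position would need a value of at least m + 2, but only the values 0 to m + 1 exist.
    strict-vanishes : ∀ m → strict x t (suc m) (suc (suc m)) ≈ 0#
    strict-vanishes m = Σ-zero (λ σ → trans
      (*-congʳ (δ-false (opens? (suc m) (suc (suc m)) σ) λ opens → ℕ.<⇒≱ (Fin.toℕ<n (σ ⟨$⟩ʳ zero)) (opens zero (s≤s ℕ.z≤n))))
      (zeroˡ _)) (𝔖 (suc (suc m)))

  module _ {x t x′ t′ c : Carrier} (1+t′≈ : 1# + t′ ≈ c * (1# + t)) (x′t′≈ : x′ * t′ ≈ (c * c) * (x * t)) where

    -- Induction on k = n - m, which every step lowers by one: an up step raises m, a level step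
    -- removes a point, a down step removes two points and lowers m. Each removed point accounts for
    -- one factor c.
    strict-scale : ∀ k m n → n ≡ k ℕ.+ m → strict x′ t′ m (suc n) ≈ c ^ n * strict x t m (suc n)
    -- The only permutation of one point has neither peak nor excedance, so both enumerators compute
    -- to the same expression.
    strict-scale zero zero    n ≡.refl = sym (*-identityˡ _)
    strict-scale zero (suc m) n ≡.refl = trans (strict-vanishes m) (sym (trans (*-congˡ (strict-vanishes m)) (zeroʳ _)))
    strict-scale (suc k) zero n ≡.refl = begin
      strict x′ t′ 0 (suc n)
        ≈⟨ strict-zero-recurrence n′ ⟩
      (1# + t′) * (stepWeight n 0 * strict x′ t′ 0 n) + strict x′ t′ 1 (suc n)
        ≈⟨ +-cong (*-cong 1+t′≈ (*-congˡ (strict-scale k 0 n′ ≡.refl)))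
                  (strict-scale k 1 n (≡.sym (ℕ.+-suc k 0))) ⟩
      (c * (1# + t)) * (stepWeight n 0 * (c ^ n′ * strict x t 0 n)) + (c * c ^ n′) * strict x t 1 (suc n)
        ≈⟨ solve 6 (λ c u w d s r → (c :* u) :* (w :* (d :* s)) :+ (c :* d) :* r := (c :* d) :* (u :* (w :* s) :+ r))
             refl c (1# + t) _ (c ^ n′) _ _ ⟩
      c ^ n * ((1# + t) * (stepWeight n 0 * strict x t 0 n) + strict x t 1 (suc n))
        ≈⟨ *-congˡ (strict-zero-recurrence n′) ⟨
      c ^ n * strict x t 0 (suc n) ∎
      where n′ = k ℕ.+ 0
    -- Here n is `suc (k + suc m)`; moving the inner successor outward gives the sizes in the
    -- recurrence.
    strict-scale (suc k) (suc m) n ≡.refl = trans (reflexive (cong (λ j → strict x′ t′ (suc m) (suc (suc j))) (ℕ.+-suc k m)))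
      (trans step (reflexive (cong (λ j → c ^ suc j * strict x t (suc m) (suc (suc j))) (≡.sym (ℕ.+-suc k m)))))
      where
      j = k ℕ.+ m
      step : strict x′ t′ (suc m) (suc (suc (suc j))) ≈ c ^ suc (suc j) * strict x t (suc m) (suc (suc (suc j)))
      step = begin
        strict x′ t′ (suc m) (suc (suc (suc j)))
          ≈⟨ strict-suc-recurrence m (suc j) m<j ⟩
        (x′ * t′) * (w * (w′ * strict x′ t′ m (suc j))) + (1# + t′) * (w * strict x′ t′ (suc m) (suc (suc j)))
          + strict x′ t′ (suc (suc m)) (suc (suc (suc j)))
          ≈⟨ +-cong (+-cong (*-cong x′t′≈ (*-congˡ (*-congˡ (strict-scale k m j ≡.refl))))
                            (*-cong 1+t′≈ (*-congˡ (strict-scale k (suc m) (suc j) (≡.sym (ℕ.+-suc k m))))))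
                    (strict-scale k (suc (suc m)) (suc (suc j)) (≡.sym (≡.trans (ℕ.+-suc k (suc m)) (cong suc (ℕ.+-suc k m))))) ⟩
        ((c * c) * (x * t)) * (w * (w′ * (c ^ j * f))) + (c * (1# + t)) * (w * ((c * c ^ j) * s)) + (c * (c * c ^ j)) * r
          ≈⟨ solve 9 (λ c y u w w′ d f s r →
               ((c :* c) :* y) :* (w :* (w′ :* (d :* f))) :+ (c :* u) :* (w :* ((c :* d) :* s)) :+ (c :* (c :* d)) :* r
                 := (c :* (c :* d)) :* (y :* (w :* (w′ :* f)) :+ u :* (w :* s) :+ r))
               refl c (x * t) (1# + t) w w′ (c ^ j) f s r ⟩
        c ^ suc (suc j) * ((x * t) * (w * (w′ * f)) + (1# + t) * (w * s) + r)
          ≈⟨ *-congˡ (strict-suc-recurrence m (suc j) m<j) ⟨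
        c ^ suc (suc j) * strict x t (suc m) (suc (suc (suc j))) ∎
        where
        m<j : suc m < suc (suc j)
        m<j = s≤s (s≤s (ℕ.m≤n+m m k))
        w = stepWeight (suc (suc j)) (suc m)
        w′ = stepWeight (suc j) m
        f = strict x t m (suc j)
        s = strict x t (suc m) (suc (suc j))
        r = strict x t (suc (suc m)) (suc (suc (suc j)))

-- Rational and quadratic substitutions

-- Equality in an arbitrary ring is not decidable. With coefficients from ℤ, mapped into the ring,
-- the solver can still recognise cancelling terms.
module IntegerSolver {c ℓ} (R : CommutativeRing c ℓ) where

  open CommutativeRing R hiding (zero)
  open import Algebra.Properties.Ring ring
    using (-‿+-comm; -‿distribˡ-*; -‿distribʳ-*; -‿involutive; -0#≈0#)
  open import Algebra.Properties.CommutativeSemigroup +-commutativeSemigroup using (interchange)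
  open import Algebra.Properties.Semiring.Mult.TCOptimised semiring
    using (×-homo-+; ×1-homo-*; 1+×) renaming (_×_ to _·_)
  open import Relation.Binary.Reasoning.Setoid setoid

  ⟦_⟧ℤ : ℤ → Carrier
  ⟦ + n      ⟧ℤ = n · 1#
  ⟦ -[1+ n ] ⟧ℤ = - (suc n · 1#)

  ⊖-homo : ∀ m n → ⟦ m ℤ.⊖ n ⟧ℤ ≈ m · 1# - n · 1#
  ⊖-homo zero    zero    = sym (-‿inverseʳ 0#)
  ⊖-homo zero    (suc n) = sym (+-identityˡ _)
  ⊖-homo (suc m) zero    = sym (trans (+-congˡ -0#≈0#) (+-identityʳ _))
  ⊖-homo (suc m) (suc n) = begin
    ⟦ suc m ℤ.⊖ suc n ⟧ℤ                     ≡⟨ cong ⟦_⟧ℤ (ℤ.[1+m]⊖[1+n]≡m⊖n m n) ⟩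
    ⟦ m ℤ.⊖ n ⟧ℤ                             ≈⟨ ⊖-homo m n ⟩
    m · 1# - n · 1#                          ≈⟨ +-identityˡ _ ⟨
    0# + (m · 1# - n · 1#)                   ≈⟨ +-congʳ (-‿inverseʳ 1#) ⟨
    (1# - 1#) + (m · 1# - n · 1#)            ≈⟨ interchange _ _ _ _ ⟩
    (1# + m · 1#) + (- 1# - n · 1#)          ≈⟨ +-congˡ (-‿+-comm 1# (n · 1#)) ⟩
    (1# + m · 1#) - (1# + n · 1#)            ≈⟨ +-cong (1+× m 1#) (-‿cong (1+× n 1#)) ⟨
    suc m · 1# - suc n · 1#                  ∎

  ℤ-+-homo : ∀ i j → ⟦ i ℤ.+ j ⟧ℤ ≈ ⟦ i ⟧ℤ + ⟦ j ⟧ℤ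
  ℤ-+-homo (+ m)    (+ n)    = ×-homo-+ 1# m n
  ℤ-+-homo (+ m)    -[1+ n ] = ⊖-homo m (suc n)
  ℤ-+-homo -[1+ m ] (+ n)    = trans (⊖-homo n (suc m)) (+-comm _ _)
  ℤ-+-homo -[1+ m ] -[1+ n ] = trans
    (-‿cong (trans (reflexive (cong (λ k → suc k · 1#) (≡.sym (ℕ.+-suc m n)))) (×-homo-+ 1# (suc m) (suc n))))
    (sym (-‿+-comm _ _))

  ℤ-‿homo : ∀ i → ⟦ ℤ.- i ⟧ℤ ≈ - ⟦ i ⟧ℤ
  ℤ-‿homo (+ zero)  = sym -0#≈0#
  ℤ-‿homo (+ suc n) = refl
  ℤ-‿homo -[1+ n ]  = sym (-‿involutive _)

  ℤ-pos-*-pos : ∀ m n → ⟦ + m ℤ.* + n ⟧ℤ ≈ m · 1# * n · 1#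
  ℤ-pos-*-pos m n = trans (reflexive (cong ⟦_⟧ℤ (≡.sym (ℤ.pos-* m n)))) (×1-homo-* m n)

  ℤ-pos-*-homo : ∀ m j → ⟦ + m ℤ.* j ⟧ℤ ≈ m · 1# * ⟦ j ⟧ℤ
  ℤ-pos-*-homo m (+ n)    = ℤ-pos-*-pos m n
  ℤ-pos-*-homo m -[1+ n ] = begin
    ⟦ + m ℤ.* -[1+ n ] ⟧ℤ          ≡⟨ cong ⟦_⟧ℤ (ℤ.neg-distribʳ-* (+ m) (+ suc n)) ⟨
    ⟦ ℤ.- (+ m ℤ.* + suc n) ⟧ℤ     ≈⟨ ℤ-‿homo (+ m ℤ.* + suc n) ⟩
    - ⟦ + m ℤ.* + suc n ⟧ℤ         ≈⟨ -‿cong (ℤ-pos-*-pos m (suc n)) ⟩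
    - (m · 1# * suc n · 1#)        ≈⟨ -‿distribʳ-* _ _ ⟩
    m · 1# * - (suc n · 1#)        ∎

  ℤ-*-homo : ∀ i j → ⟦ i ℤ.* j ⟧ℤ ≈ ⟦ i ⟧ℤ * ⟦ j ⟧ℤ
  ℤ-*-homo (+ m)    j = ℤ-pos-*-homo m j
  ℤ-*-homo -[1+ m ] j = begin
    ⟦ -[1+ m ] ℤ.* j ⟧ℤ            ≡⟨ cong ⟦_⟧ℤ (ℤ.neg-distribˡ-* (+ suc m) j) ⟨
    ⟦ ℤ.- (+ suc m ℤ.* j) ⟧ℤ       ≈⟨ ℤ-‿homo (+ suc m ℤ.* j) ⟩
    - ⟦ + suc m ℤ.* j ⟧ℤ           ≈⟨ -‿cong (ℤ-pos-*-homo (suc m) j) ⟩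
    - (suc m · 1# * ⟦ j ⟧ℤ)        ≈⟨ -‿distribˡ-* _ _ ⟩
    - (suc m · 1#) * ⟦ j ⟧ℤ        ∎

  ℤ⟶R : ℤ.+-*-rawRing -Raw-AlmostCommutative⟶ fromCommutativeRing R
  ℤ⟶R = record
    { ⟦_⟧    = ⟦_⟧ℤ
    ; +-homo = ℤ-+-homo
    ; *-homo = ℤ-*-homo
    ; -‿homo = ℤ-‿homo
    ; 0-homo = refl
    ; 1-homo = refl
    }

  _coeff≟_ : ∀ i j → Maybe (⟦ i ⟧ℤ ≈ ⟦ j ⟧ℤ)
  i coeff≟ j = Maybe.map (λ i≡j → reflexive (cong ⟦_⟧ℤ i≡j)) (dec⇒maybe (i ℤ.≟ j))

  open Algebra.Solver.Ring ℤ.+-*-rawRing (fromCommutativeRing R) ℤ⟶R _coeff≟_ public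

module Substitutions {c ℓ} (R : CommutativeRing c ℓ) where

  open CommutativeRing R hiding (zero; _-_; Carrier; _+_; _*_; _≈_; 1#)
  open Polynomials R
  open import Relation.Binary.Reasoning.Setoid setoid
  open import Algebra.Properties.Semiring.Exp semiring using (^-congʳ)
  open IntegerSolver R using (Polynomial; solve; _:=_; _:+_; _:*_; _:-_; con)

  module _ (p q : Carrier) where

    open Transfer R p q
    open Sums R using (Σ-cong; δ-true)

    -- At height 0 the condition on open positions is vacuous, so its indicator is 1.
    weight-strict : ∀ {x t n} σ → p ^ nest {n} σ * (q ^ cros σ * (x ^ cpk* σ * (t ^ exc σ * 1#)))
                                    ≈ Sums.δ R (opens? 0 1 σ) * weight x t σ
    weight-strict {x} {t} σ = trans
      (*-cong (^-congʳ p (nest≡pairs σ)) (*-cong (^-congʳ q (cros≡pairs σ))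
        (*-cong (^-congʳ x (cpk*≡pairs σ)) (*-congʳ (^-congʳ t (exc≡excs σ))))))
      (sym (trans (*-congʳ (δ-true (opens? 0 1 σ) λ _ ())) (*-identityˡ _)))

    P≈strict : ∀ n x t → P (nest ∷ cros ∷ cpk* ∷ exc ∷ []) (𝔖 n) (p ∷ q ∷ x ∷ t ∷ []) ≈ strict x t 0 n
    P≈strict n x t = Σ-cong weight-strict (𝔖 n)

    A≈strict : ∀ n t → A n p q t ≈ strict 1# t 0 n
    A≈strict n t = Σ-cong (λ σ → trans
      (trans (*-assoc _ _ _) (*-congˡ (*-congˡ
        (sym (trans (*-cong (1^n≈1 (cpk* σ)) (*-identityʳ _)) (*-identityˡ _))))))
      (weight-strict σ)) (𝔖 n)

    strict-transform : ∀ {x t x′ t′ c} → 1# + t′ ≈ c * (1# + t) → x′ * t′ ≈ (c * c) * (x * t) →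
                       ∀ n → strict x′ t′ 0 (suc n) ≈ c ^ n * strict x t 0 (suc n)
    strict-transform e₁ e₂ n = strict-scale e₁ e₂ n 0 n (≡.sym (ℕ.+-identityʳ n))

  private
    :1 :2 : ∀ {n} → Polynomial n
    :1 = con (+ 1)
    :2 = :1 :+ :1

    -- The form to which `y ^ 2` unfolds.
    sq : ∀ {n} → Polynomial n → Polynomial n
    sq y = y :* (y :* :1)

  -- Let c = (1 + x t) / (1 + x), and let X and T be the new weights of peaks and excedances. Then 1
  -- + T = (1 + x)(1 + t) / (1 + x t) and X T = (1 + x)² t / (1 + x t)², so c (1 + T) = 1 + t and c²
  -- X T = t.
  module RationalWeights (t x : Carrier) {i j k : Carrier} (i⁻¹ : i * (1# + x) ≈ 1#)
           (j⁻¹ : j * (1# + x * t) ≈ 1#) (k⁻¹ : k * ((x + t) * (1# + x * t)) ≈ 1#) where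

    level : 1# + t ≈ ((1# + x * t) * i) * (1# + (x + t) * j)
    level = sym (begin
      ((1# + x * t) * i) * (1# + (x + t) * j)
        ≈⟨ solve 4 (λ t x i j → ((:1 :+ x :* t) :* i) :* (:1 :+ (x :+ t) :* j)
             := i :* (:1 :+ x :* t) :+ i :* (x :+ t) :* (j :* (:1 :+ x :* t))) refl t x i j ⟩
      i * (1# + x * t) + i * (x + t) * (j * (1# + x * t))
        ≈⟨ +-congˡ (*-congˡ j⁻¹) ⟩
      i * (1# + x * t) + i * (x + t) * 1#
        ≈⟨ solve 3 (λ t x i → i :* (:1 :+ x :* t) :+ i :* (x :+ t) :* :1
             := (i :* (:1 :+ x)) :* (:1 :+ t)) refl t x i ⟩
      (i * (1# + x)) * (1# + t)
        ≈⟨ *-congʳ i⁻¹ ⟩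
      1# * (1# + t)
        ≈⟨ *-identityˡ _ ⟩
      1# + t ∎)

    updown : 1# * t ≈ (((1# + x * t) * i) * ((1# + x * t) * i)) * ((((1# + x) ^ 2 * t) * k) * ((x + t) * j))
    updown = sym (begin
      (((1# + x * t) * i) * ((1# + x * t) * i)) * ((((1# + x) ^ 2 * t) * k) * ((x + t) * j))
        ≈⟨ solve 5 (λ t x i j k →
             (((:1 :+ x :* t) :* i) :* ((:1 :+ x :* t) :* i)) :* (((sq (:1 :+ x) :* t) :* k) :* ((x :+ t) :* j))
               := ((i :* (:1 :+ x)) :* (i :* (:1 :+ x)))
                  :* ((j :* (:1 :+ x :* t)) :* (k :* ((x :+ t) :* (:1 :+ x :* t)))) :* t) refl t x i j k ⟩
      ((i * (1# + x)) * (i * (1# + x))) * ((j * (1# + x * t)) * (k * ((x + t) * (1# + x * t)))) * t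
        ≈⟨ *-congʳ (*-cong (*-cong i⁻¹ i⁻¹) (*-cong j⁻¹ k⁻¹)) ⟩
      (1# * 1#) * (1# * 1#) * t
        ≈⟨ *-congʳ (trans (*-cong (*-identityˡ 1#) (*-identityˡ 1#)) (*-identityˡ 1#)) ⟩
      1# * t ∎)

  module QuadraticWeights (t x s : Carrier) (s² : s ^ 2 ≈ (1# + t) ^ 2 - 4# * x * t) {d e g : Carrier}
           (d⁻¹ : d * (2# * x * t) ≈ 1#) (e⁻¹ : e * (2# * (1# - x) * t) ≈ 1#) where

    N₁ N₂ u v h a b : Carrier
    N₁ = (1# + t) ^ 2 - 2# * x * t - (1# + t) * s
    N₂ = 1# + t ^ 2 - 2# * x * t - (1# - t) * s
    u = N₂ * e
    v = N₁ * d
    -- h is the inverse of 2.  With a and b as below, a b = 4 x t, so that v = a / b and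
    -- (1 + u) / (1 + u v) = b / 2.
    h = x * t * d
    a = 1# + t - s
    b = 1# + t + s

    2h≈1 : 2# * h ≈ 1#
    2h≈1 = trans (solve 3 (λ t x d → :2 :* (x :* t :* d) := d :* (:2 :* x :* t)) refl t x d) d⁻¹

    ab≈4xt : a * b ≈ 4# * x * t
    ab≈4xt = begin
      a * b                                    ≈⟨ solve 2 (λ t s → (:1 :+ t :- s) :* (:1 :+ t :+ s)
                                                    := sq (:1 :+ t) :- sq s) refl t s ⟩
      (1# + t) ^ 2 - s ^ 2                     ≈⟨ +-congˡ (-‿cong s²) ⟩
      (1# + t) ^ 2 - ((1# + t) ^ 2 - 4# * x * t)
        ≈⟨ solve 2 (λ t x → sq (:1 :+ t) :- (sq (:1 :+ t) :- (:2 :+ :2) :* x :* t)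
             := (:2 :+ :2) :* x :* t) refl t x ⟩
      4# * x * t                               ∎

    -- Since N₁ = (1 + t) a - 2 x t and a + b = 2 (1 + t), the product b N₁ equals 2 x t a.
    bh*v≈ah : (b * h) * v ≈ a * h
    bh*v≈ah = begin
      (b * h) * v
        ≈⟨ solve 5 (λ t x s d h →
             ((:1 :+ t :+ s) :* h) :* ((sq (:1 :+ t) :- :2 :* x :* t :- (:1 :+ t) :* s) :* d)
               := (h :* d) :* ((:1 :+ t) :* ((:1 :+ t :- s) :* (:1 :+ t :+ s)) :- :2 :* x :* t :* (:1 :+ t :+ s)))
             refl t x s d h ⟩
      (h * d) * ((1# + t) * (a * b) - 2# * x * t * b)
        ≈⟨ *-congˡ (+-congʳ (*-congˡ ab≈4xt)) ⟩
      (h * d) * ((1# + t) * (4# * x * t) - 2# * x * t * b)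
        ≈⟨ solve 5 (λ t x s d h →
             (h :* d) :* ((:1 :+ t) :* ((:2 :+ :2) :* x :* t) :- :2 :* x :* t :* (:1 :+ t :+ s))
               := (d :* (:2 :* x :* t)) :* ((:1 :+ t :- s) :* h)) refl t x s d h ⟩
      (d * (2# * x * t)) * (a * h)
        ≈⟨ trans (*-congʳ d⁻¹) (*-identityˡ _) ⟩
      a * h ∎

    -- Rationalising: N₂ (1 - t + s) becomes 2 (1 - x) t (t - 1 + s) once s² is replaced. This
    -- expresses u as a quotient without inverting 1 - t + s.
    u*[1-t+s] : u * (1# - t + s) ≈ t - 1# + s
    u*[1-t+s] = begin
      u * (1# - t + s)
        ≈⟨ solve 4 (λ t x s e →
             ((:1 :+ sq t :- :2 :* x :* t :- (:1 :- t) :* s) :* e) :* (:1 :- t :+ s)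
               := e :* ((:1 :+ sq t :- :2 :* x :* t) :* (:1 :- t) :+ (:2 :* t :- :2 :* x :* t) :* s :- (:1 :- t) :* sq s))
             refl t x s e ⟩
      e * ((1# + t ^ 2 - 2# * x * t) * (1# - t) + (2# * t - 2# * x * t) * s - (1# - t) * s ^ 2)
        ≈⟨ *-congˡ (+-congˡ (-‿cong (*-congˡ s²))) ⟩
      e * ((1# + t ^ 2 - 2# * x * t) * (1# - t) + (2# * t - 2# * x * t) * s
           - (1# - t) * ((1# + t) ^ 2 - 4# * x * t))
        ≈⟨ solve 4 (λ t x s e →
             e :* ((:1 :+ sq t :- :2 :* x :* t) :* (:1 :- t) :+ (:2 :* t :- :2 :* x :* t) :* s
                   :- (:1 :- t) :* (sq (:1 :+ t) :- (:2 :+ :2) :* x :* t))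
               := (e :* (:2 :* (:1 :- x) :* t)) :* (t :- :1 :+ s)) refl t x s e ⟩
      (e * (2# * (1# - x) * t)) * (t - 1# + s)
        ≈⟨ trans (*-congʳ e⁻¹) (*-identityˡ _) ⟩
      t - 1# + s ∎

    -- Writing 2 u as u (1 - t + s) + u a turns 2 (1 + u) into b + u a, and a h is b h v.
    1+u≈bh*[1+uv] : 1# + u ≈ (b * h) * (1# + u * v)
    1+u≈bh*[1+uv] = begin
      1# + u
        ≈⟨ trans (*-congʳ 2h≈1) (*-identityˡ _) ⟨
      (2# * h) * (1# + u)
        ≈⟨ solve 4 (λ t s u h → (:2 :* h) :* (:1 :+ u)
             := h :* (:2 :+ u :* (:1 :- t :+ s) :+ u :* (:1 :+ t :- s))) refl t s u h ⟩
      h * (2# + u * (1# - t + s) + u * a)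
        ≈⟨ *-congˡ (+-congʳ (+-congˡ u*[1-t+s])) ⟩
      h * (2# + (t - 1# + s) + u * a)
        ≈⟨ solve 4 (λ t s u h → h :* (:2 :+ (t :- :1 :+ s) :+ u :* (:1 :+ t :- s))
             := (:1 :+ t :+ s) :* h :+ u :* ((:1 :+ t :- s) :* h)) refl t s u h ⟩
      b * h + u * (a * h)
        ≈⟨ +-congˡ (*-congˡ bh*v≈ah) ⟨
      b * h + u * ((b * h) * v)
        ≈⟨ solve 3 (λ c u v → c :+ u :* (c :* v) := c :* (:1 :+ u :* v)) refl (b * h) u v ⟩
      (b * h) * (1# + u * v) ∎

    module _ (g⁻¹ : g * (1# + u * v) ≈ 1#) where

      scale≈bh : (1# + u) * g ≈ b * h
      scale≈bh = begin
        (1# + u) * g                     ≈⟨ *-congʳ 1+u≈bh*[1+uv] ⟩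
        (b * h) * (1# + u * v) * g       ≈⟨ *-assoc _ _ _ ⟩
        (b * h) * ((1# + u * v) * g)     ≈⟨ *-congˡ (trans (*-comm _ _) g⁻¹) ⟩
        (b * h) * 1#                     ≈⟨ *-identityʳ _ ⟩
        b * h                            ∎

      -- With c the scaling factor, c and c v are b / 2 and a / 2. Their sum is 1 + t and their
      -- product is x t, which are the two hypotheses of `strict-transform`.
      level : 1# + t ≈ ((1# + u) * g) * (1# + v)
      level = sym (begin
        ((1# + u) * g) * (1# + v)        ≈⟨ *-congʳ scale≈bh ⟩
        (b * h) * (1# + v)               ≈⟨ trans (distribˡ _ _ _) (+-cong (*-identityʳ _) bh*v≈ah) ⟩
        b * h + a * h                    ≈⟨ solve 3 (λ t s h → (:1 :+ t :+ s) :* h :+ (:1 :+ t :- s) :* h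
                                              := (:2 :* h) :* (:1 :+ t)) refl t s h ⟩
        (2# * h) * (1# + t)              ≈⟨ trans (*-congʳ 2h≈1) (*-identityˡ _) ⟩
        1# + t                           ∎)

      updown : x * t ≈ (((1# + u) * g) * ((1# + u) * g)) * (1# * v)
      updown = sym (begin
        (((1# + u) * g) * ((1# + u) * g)) * (1# * v)
          ≈⟨ *-congʳ (*-cong scale≈bh scale≈bh) ⟩
        ((b * h) * (b * h)) * (1# * v)
          ≈⟨ solve 2 (λ c v → (c :* c) :* (:1 :* v) := c :* (c :* v)) refl (b * h) v ⟩
        (b * h) * ((b * h) * v)
          ≈⟨ *-congˡ bh*v≈ah ⟩
        (b * h) * (a * h)
          ≈⟨ solve 3 (λ a b h → (b :* h) :* (a :* h) := (h :* h) :* (a :* b)) refl a b h ⟩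
        (h * h) * (a * b)
          ≈⟨ *-congˡ ab≈4xt ⟩
        (h * h) * (4# * x * t)
          ≈⟨ solve 3 (λ t x h → (h :* h) :* ((:2 :+ :2) :* x :* t)
               := (:2 :* h) :* (:2 :* h) :* (x :* t)) refl t x h ⟩
        (2# * h) * (2# * h) * (x * t)
          ≈⟨ *-congʳ (*-cong 2h≈1 2h≈1) ⟩
        (1# * 1#) * (x * t)
          ≈⟨ trans (*-congʳ (*-identityˡ 1#)) (*-identityˡ _) ⟩
        x * t ∎)

theorem3p1 : ∀ {c ℓ} (R : CommutativeRing c ℓ) (n : ℕ) → n ≥ 1 →
    let open Polynomials R in
    (p q t x : Carrier) →
    ( ⦃ _ : Unit (1# + x) ⦄
      ⦃ _ : Unit (1# + x * t) ⦄
      ⦃ _ : Unit ((x + t) * (1# + x * t)) ⦄ →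
      A n p q t
        ≈ ((1# + x * t) / (1# + x)) ^ (n ∸ 1)
          * P (nest ∷ cros ∷ cpk* ∷ exc ∷ []) (𝔖 n)
              (p ∷ q ∷ ((1# + x) ^ 2 * t) / ((x + t) * (1# + x * t)) ∷ (x + t) / (1# + x * t) ∷ []) )
    ×
    ( (s : Carrier) → s ^ 2 ≈ (1# + t) ^ 2 - 4# * x * t →
      ⦃ _ : Unit (2# * (1# - x) * t) ⦄
      ⦃ _ : Unit (2# * x * t) ⦄ →
      let u = (1# + t ^ 2 - 2# * x * t - (1# - t) * s) / (2# * (1# - x) * t)
          v = ((1# + t) ^ 2 - 2# * x * t - (1# + t) * s) / (2# * x * t)
      in
      ⦃ _ : Unit (1# + u * v) ⦄ →
      P (nest ∷ cros ∷ cpk* ∷ exc ∷ []) (𝔖 n) (p ∷ q ∷ x ∷ t ∷ [])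
        ≈ ((1# + u) / (1# + u * v)) ^ (n ∸ 1) * A n p q v )
theorem3p1 R (suc n) _ p q t x = first , second
  where
  open Polynomials R
  open CommutativeRing R using (trans; sym; *-congˡ)
  open Substitutions R

  first : ⦃ _ : Unit (1# + x) ⦄ ⦃ _ : Unit (1# + x * t) ⦄ ⦃ _ : Unit ((x + t) * (1# + x * t)) ⦄ → _
  first ⦃ _ , i⁻¹ , _ ⦄ ⦃ _ , j⁻¹ , _ ⦄ ⦃ _ , k⁻¹ , _ ⦄ =
    -- The transform leads from the weights in `P` to peak weight 1 and excedance weight t.
    trans (A≈strict p q (suc n) t)
      (trans (strict-transform p q W.level W.updown n) (*-congˡ (sym (P≈strict p q (suc n) _ _))))
    where module W = RationalWeights t x i⁻¹ j⁻¹ k⁻¹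

  second : ∀ s → s ^ 2 ≈ (1# + t) ^ 2 - 4# * x * t → _
  second s s² ⦃ _ , e⁻¹ , _ ⦄ ⦃ _ , d⁻¹ , _ ⦄ ⦃ _ , g⁻¹ , _ ⦄ =
    -- Here the transform starts from peak weight 1 and excedance weight v.
    trans (P≈strict p q (suc n) x t)
      (trans (strict-transform p q (W.level g⁻¹) (W.updown g⁻¹) n) (*-congˡ (sym (A≈strict p q (suc n) _))))
    where module W = QuadraticWeights t x s s² d⁻¹ e⁻¹
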